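{- Let $g\ge1$, $n\ge3$, and let $A=(\alpha_1,\dots,\alpha_n)$ be positive integers with $\alpha_1\le\dots\le\alpha_n$ and $\sum_{i=1}^n 1/\alpha_i=1/g$. Put $F_k(A)=\dfrac{\alpha_1\cdots\alpha_n}{\mathrm{lcm}(\alpha_1,\dots,\alpha_n)^{n-k}}$. \begin{enumerate} \item $F_n(A)\le t_{g,n}^2/g$, with equality if and only if $A=(s_{g,1},\dots,s_{g,n-1},t_{g,n})$. \item If $(n,g)=(3,1)$, then $F_{2}(A)\le 9$ with equality iff $A=(3,3,3)$. Otherwise $F_{n-1}(A)\le 2t_{g,n-1}^2/g$, with equality if and only if $A$ is one of $(6,6,6)$, $(2,6,6,6)$, $(s_{g,1},\dots,s_{g,n-2},2t_{g,n-1},2t_{g,n-1})$. \item If $n=4$ and $g\in\{1,2\}$, then $F_2(A)\le 16g^2$ with equality iff $A=(4g,4g,4g,4g)$. If $(n,g)=(5,1)$, then $F_3(A)\le128$ with equality iff $A=(2,8,8,8,8)$. In all other cases $F_{n-2}(A)\le 3t_{g,n-2}^2/g$, with equality if and only if $A$ is one of $(12,12,12,12)$, $(s_{g,1},\dots,s_{g,n-3},3t_{g,n-2},3t_{g,n-2},3t_{g,n-2})$. \end{enumerate}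
   Context: Sylvester sequences: $s_{g,1}=g+1$, $s_{g,k+1}=s_{g,k}(s_{g,k}-1)+1$, and $t_{g,k}=s_{g,k}-1$. -}

module Defs where

open import Data.Integer.Base using (+_)
open import Data.List.Base using (List; []; _∷_; applyUpTo; foldr; length)
open import Data.List.Relation.Unary.All using (All; []; _∷_)
open import Data.Nat.Base using (ℕ; zero; suc; _+_; _*_; _∸_; _^_; NonZero; ≢-nonZero; ≢-nonZero⁻¹)
open import Data.Nat.GCD using (gcd)
open import Data.Nat.LCM using (lcm; gcd*lcm)
open import Data.Nat.ListAction using (product)
open import Data.Nat.Properties using (m*n≢0; m^n≢0; *-zeroʳ)
open import Data.Rational.Base as ℚ using (ℚ; 0ℚ; _/_)
open import Relation.Binary.PropositionalEquality using (sym; trans; cong)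

-- The sequence starts at index 1; the value at index 0 is a dummy.
s : ℕ → ℕ → ℕ
s g zero            = 0
s g (suc zero)      = g + 1
s g (suc k@(suc _)) = s g k * (s g k ∸ 1) + 1

-- For k ≥ 1 we have s g k ≥ 1, so the subtraction does not truncate.
t : ℕ → ℕ → ℕ
t g k = s g k ∸ 1

-- (s g 1 , … , s g m)
sylvester : ℕ → ℕ → List ℕ
sylvester g m = applyUpTo (λ i → s g (suc i)) m

reciprocalSum : (A : List ℕ) → All NonZero A → ℚ
reciprocalSum []      []          = 0ℚ
reciprocalSum (a ∷ A) (a≢0 ∷ A≢0) = (_/_ (+ 1) a {{a≢0}}) ℚ.+ reciprocalSum A A≢0

lcms : List ℕ → ℕ
lcms = foldr lcm 1

lcm≢0 : ∀ m n .{{_ : NonZero m}} .{{_ : NonZero n}} → NonZero (lcm m n)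
lcm≢0 m n = ≢-nonZero λ lcm≡0 →
  ≢-nonZero⁻¹ (m * n) {{m*n≢0 m n}}
    (trans (sym (gcd*lcm m n)) (trans (cong (gcd m n *_) lcm≡0) (*-zeroʳ (gcd m n))))

lcms≢0 : ∀ {A} → All NonZero A → NonZero (lcms A)
lcms≢0 []                  = _
lcms≢0 {a ∷ A} (a≢0 ∷ A≢0) = lcm≢0 a (lcms A) {{a≢0}} {{lcms≢0 A≢0}}

-- Used only for k ≤ length A, where the exponent does not truncate.
F : ℕ → (A : List ℕ) → All NonZero A → ℚ
F k A A≢0 = _/_ (+ product A) (lcms A ^ (length A ∸ k))
  {{m^n≢0 (lcms A) (length A ∸ k) {{lcms≢0 A≢0}}}}

{-# OPTIONS --safe #-}
module Submission where

-- Subtract 1/α₁, …, 1/α_l from 1/g and write the remainder as N/P with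
-- P = g α₁ ⋯ α_l, so that N is a positive integer. If m entries follow, then
-- α_{l+1} N ≤ m P, and F is at most X/g with X = P α_{l+1}. Hence it suffices
-- to show P² ≤ N t² for t = t_{g,l+1}; equality is attained by the Sylvester
-- prefix, where P = t and N = 1.
--
-- The inequality passes from l to l + 1 when the new remainder is at most
-- 1/α_{l+1}. The remaining steps form blocks. If W is the remainder at the
-- start of a block of length d and θ W, with 1/(e + m) ≤ θ < 1/2, is
-- subtracted when e steps of the block are left, then the product of all
-- subtracted numbers and of the final remainder is W^{d+1} times a product of
-- factors θ (1 − θ)^e. These are unimodal in θ, so bounded below by their
-- values at the end points. The resulting constants are small enough
-- to restore the inequality at the end of the block, except for blocks of
-- length one when t is small and for one block of length two when t = 1: these
-- give the sporadic extremal lists and the exceptional bounds.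

open import Defs

module EgyptianFractions where

  import Data.Integer.Base as ℤ
  import Data.Integer.Properties as ℤ
  open import Data.List.Base using (List; []; _∷_; _++_; _∷ʳ_; length; replicate)
  open import Data.List.Properties using (applyUpTo-∷ʳ; ++-assoc; ++-identityʳ; ∷ʳ-++; length-++)
  open import Data.List.Relation.Unary.All as All using (All; []; _∷_)
  import Data.List.Relation.Unary.All.Properties as All
  open import Data.List.Relation.Unary.Linked using ([]; [-]; _∷_)
  open import Data.List.Relation.Unary.Sorted.TotalOrder using (Sorted)
  open import Data.Nat.Base hiding (_/_)
  open import Data.Nat.Divisibility using (_∣_; 1∣_; ∣-refl; ∣-trans; ∣-antisym; ∣⇒≤; ∣n⇒∣m*n; m∣m*n; n∣m*n)
  open import Data.Nat.LCM using (m∣lcm[m,n]; n∣lcm[m,n]; lcm-least)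
  open import Data.Nat.ListAction using (product)
  open import Data.Nat.ListAction.Properties using (product≢0; product-++)
  open import Data.Nat.Properties
  open import Data.Nat.Tactic.RingSolver using (solve-∀)
  open import Data.Product.Base using (_×_; _,_; ∃-syntax; proj₁; proj₂)
  open import Data.Rational.Base as ℚ using (_/_; toℚᵘ)
  import Data.Rational.Properties as ℚ
  open import Data.Rational.Unnormalised.Base as ℚᵘ using (mkℚᵘ; *≡*; *≤*)
  import Data.Rational.Unnormalised.Properties as ℚᵘ
  open import Data.Sum.Base using (_⊎_; inj₁; inj₂)
  open import Function.Bundles using (_⇔_; mk⇔)
  open import Relation.Binary.PropositionalEquality
  open import Relation.Nullary.Decidable.Core using (yes; no)
  open import Relation.Nullary.Negation using (¬_; contradiction)

  -- Elementary polynomial inequalities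

  m+o≡n⇒m≤n : ∀ {m n} o → m + o ≡ n → m ≤ n
  m+o≡n⇒m≤n {m} o refl = m≤m+n m o

  ^-distribʳ-* : ∀ m n o → (m * n) ^ o ≡ m ^ o * n ^ o
  ^-distribʳ-* m n zero    = refl
  ^-distribʳ-* m n (suc o) = trans (cong (m * n *_) (^-distribʳ-* m n o)) (lemma m n (m ^ o) (n ^ o))
    where
    lemma : ∀ m n x y → m * n * (x * y) ≡ m * x * (n * y)
    lemma = solve-∀

  -- The difference of the two sides is (b − 1)(P² − b).
  square-step : ∀ {P b} → 1 ≤ b → b ≤ P → (b + P) * (b + P) ≤ b * (suc P * suc P)
  square-step {b = suc c} _ b≤P =
    let e , b+e≡P = m≤n⇒∃[o]m+o≡n b≤P in
    subst (λ P → (suc c + P) * (suc c + P) ≤ suc c * (suc P * suc P)) b+e≡P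
      (m+o≡n⇒m≤n (c * (e + suc (c + e) * (c + e))) (lemma c e))
    where
    lemma : ∀ c e → (suc c + (suc c + e)) * (suc c + (suc c + e)) + c * (e + suc (c + e) * (c + e))
                  ≡ suc c * (suc (suc c + e) * suc (suc c + e))
    lemma = solve-∀

  -- The difference is again (b - 1)(P² - b), now positive because P ≥ b ≥ 2.
  square-step-< : ∀ {P b} → 2 ≤ b → b ≤ P → (b + P) * (b + P) < b * (suc P * suc P)
  square-step-< {b = suc (suc c)} (s≤s (s≤s _)) b≤P =
    let e , b+e≡P = m≤n⇒∃[o]m+o≡n b≤P in
    subst (λ P → (2 + c + P) * (2 + c + P) < (2 + c) * (suc P * suc P)) b+e≡P
      (m+o≡n⇒m≤n (c * (e + (2 + c + e) * (1 + c + e)) + e + suc (3 * (c + e) + (c + e) * (c + e))) (lemma c e))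
    where
    lemma : ∀ c e → suc ((2 + c + (2 + c + e)) * (2 + c + (2 + c + e)))
                    + (c * (e + (2 + c + e) * (1 + c + e)) + e + suc (3 * (c + e) + (c + e) * (c + e)))
                  ≡ (2 + c) * (suc (2 + c + e) * suc (2 + c + e))
    lemma = solve-∀

  -- If P > t, the passage from t to t (t + 1) is paid for by t (P + 1) < P (t + 1).
  close-step : ∀ {P N t a b} → P * P ≤ N * (t * t) → P < N * t → 1 ≤ b → b ≤ P → b + P ≡ N * a →
               (P * a) * (P * a) < b * ((t * suc t) * (t * suc t))
  close-step {P} {N} {t} {a} {b} P²≤Nt² P<Nt 1≤b b≤P b+P≡Na with P ≤? t
  ... | yes P≤t = *-cancelˡ-< (N * N) _ _ (begin-strict
    N * N * ((P * a) * (P * a))           ≡⟨ e₁ N P a ⟩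
    (P * P) * ((N * a) * (N * a))         ≡⟨ cong (λ x → P * P * (x * x)) b+P≡Na ⟨
    (P * P) * ((b + P) * (b + P))         ≤⟨ *-monoʳ-≤ (P * P) (square-step 1≤b b≤P) ⟩
    (P * P) * (b * (suc P * suc P))       ≤⟨ *-monoʳ-≤ (P * P) (*-monoʳ-≤ b (*-mono-≤ (s≤s P≤t) (s≤s P≤t))) ⟩
    (P * P) * (b * (suc t * suc t))       <⟨ *-monoˡ-< _ {{>-nonZero (*-mono-≤ 1≤b (s≤s (z≤n {t + t * suc t})))}} (*-mono-< P<Nt P<Nt) ⟩
    (N * t * (N * t)) * (b * (suc t * suc t)) ≡⟨ e₂ N t b ⟩
    N * N * (b * ((t * suc t) * (t * suc t))) ∎)
    where
    open ≤-Reasoning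
    e₁ : ∀ N P a → N * N * ((P * a) * (P * a)) ≡ (P * P) * ((N * a) * (N * a))
    e₁ = solve-∀
    e₂ : ∀ N t b → (N * t * (N * t)) * (b * (suc t * suc t)) ≡ N * N * (b * ((t * suc t) * (t * suc t)))
    e₂ = solve-∀
  ... | no P≰t = *-cancelˡ-< (t * t * (N * N)) _ _ (begin-strict
    t * t * (N * N) * ((P * a) * (P * a))     ≡⟨ e₁ N P a t ⟩
    t * t * (P * P * ((N * a) * (N * a)))     ≡⟨ cong (λ x → t * t * (P * P * (x * x))) b+P≡Na ⟨
    t * t * (P * P * ((b + P) * (b + P)))     ≤⟨ *-monoʳ-≤ (t * t) (*-monoʳ-≤ (P * P) (square-step 1≤b b≤P)) ⟩
    t * t * (P * P * (b * (suc P * suc P)))   ≡⟨ e₂ P t b ⟩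
    (P * P * b) * ((t * suc P) * (t * suc P)) <⟨ *-monoʳ-< (P * P * b) {{>-nonZero (*-mono-≤ (*-mono-≤ 1≤P 1≤P) 1≤b)}} (*-mono-< lt lt) ⟩
    (P * P * b) * ((P * suc t) * (P * suc t)) ≡⟨ e₃ P t b ⟩
    (P * P) * (P * P) * (b * (suc t * suc t)) ≤⟨ *-monoˡ-≤ (b * (suc t * suc t)) (*-mono-≤ P²≤Nt² P²≤Nt²) ⟩
    (N * (t * t)) * (N * (t * t)) * (b * (suc t * suc t)) ≡⟨ e₄ N t b ⟩
    t * t * (N * N) * (b * ((t * suc t) * (t * suc t))) ∎)
    where
    open ≤-Reasoning
    t<P : t < P
    t<P = ≰⇒> P≰t
    1≤P : 1 ≤ P
    1≤P = ≤-trans 1≤b b≤P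
    lt : t * suc P < P * suc t
    lt = begin-strict
      t * suc P ≡⟨ *-suc t P ⟩
      t + t * P <⟨ +-monoˡ-< (t * P) t<P ⟩
      P + t * P ≡⟨ cong (P +_) (*-comm t P) ⟩
      P + P * t ≡⟨ *-suc P t ⟨
      P * suc t ∎
    e₁ : ∀ N P a t → t * t * (N * N) * ((P * a) * (P * a)) ≡ t * t * (P * P * ((N * a) * (N * a)))
    e₁ = solve-∀
    e₂ : ∀ P t b → t * t * (P * P * (b * (suc P * suc P))) ≡ (P * P * b) * ((t * suc P) * (t * suc P))
    e₂ = solve-∀
    e₃ : ∀ P t b → (P * P * b) * ((P * suc t) * (P * suc t)) ≡ (P * P) * (P * P) * (b * (suc t * suc t))
    e₃ = solve-∀
    e₄ : ∀ N t b → (N * (t * t)) * (N * (t * t)) * (b * (suc t * suc t)) ≡ t * t * (N * N) * (b * ((t * suc t) * (t * suc t)))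
    e₄ = solve-∀

  -- The difference of the two sides is (m P − N)(m N − P).
  endpoint-quadratic : ∀ {P N q} m → P < N → suc m * P ≡ N + q →
    ∃[ z ] 1 ≤ z × suc m * ((N + P) * (N + P)) + q * z ≡ (2 + m) * (2 + m) * (P * N)
  endpoint-quadratic {P} {q = q} m P<N mP≡N+q with m≤n⇒∃[o]m+o≡n P<N
  ... | k , refl = z , s≤s z≤n , +-cancelʳ-≡ (N * z) _ _ (begin
      M * ((N + P) * (N + P)) + q * z + N * z     ≡⟨ e₁ (M * ((N + P) * (N + P))) q z N ⟩
      M * ((N + P) * (N + P)) + (N + q) * z       ≡⟨ cong (λ x → M * ((N + P) * (N + P)) + x * z) mP≡N+q ⟨
      M * ((N + P) * (N + P)) + M * P * z         ≡⟨ e₂ m P k ⟩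
      (2 + m) * (2 + m) * (P * N) + N * z         ∎)
    where
    open ≡-Reasoning
    M = suc m
    N = suc P + k
    z = suc (k + m * N)
    e₁ : ∀ a q z N → a + q * z + N * z ≡ a + (N + q) * z
    e₁ = solve-∀
    e₂ : ∀ m P k → suc m * ((suc P + k + P) * (suc P + k + P)) + suc m * P * suc (k + m * (suc P + k))
                 ≡ (2 + m) * (2 + m) * (P * (suc P + k)) + (suc P + k) * suc (k + m * (suc P + k))
    e₂ = solve-∀

  -- With k = N - P the difference of the two sides is k (4P² + 2Pk - k²), positive for 1 ≤ k ≤ 3P.
  -- In terms of θ = P / (N + P) this says θ (1 - θ)² > 1/8 on [1/5, 1/2): the end point value 1/8
  -- at 1/2 is below the value 16/125 at 1/5.
  cube-bound-< : ∀ {P N} → 1 ≤ P → P < N → N ≤ 4 * P →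
                 (N + P) * ((N + P) * (N + P)) < 8 * (P * (N * N))
  cube-bound-< {P} 1≤P P<N N≤4P with m≤n⇒∃[o]m+o≡n P<N
  ... | c , refl = +-cancelʳ-< (k * (4 * (P * P) + 2 * (P * k))) _ _ (begin-strict
    (N + P) * ((N + P) * (N + P)) + k * (4 * (P * P) + 2 * (P * k)) ≡⟨ cong (λ x → (x + P) * ((x + P) * (x + P)) + k * (4 * (P * P) + 2 * (P * k))) N≡ ⟩
    (P + k + P) * ((P + k + P) * (P + k + P)) + k * (4 * (P * P) + 2 * (P * k)) ≡⟨ e₁ P k ⟨
    8 * (P * ((P + k) * (P + k))) + k * k * k <⟨ +-monoʳ-< (8 * (P * ((P + k) * (P + k)))) k³< ⟩
    8 * (P * ((P + k) * (P + k))) + k * (4 * (P * P) + 2 * (P * k)) ≡⟨ cong (λ x → 8 * (P * (x * x)) + k * (4 * (P * P) + 2 * (P * k))) N≡ ⟨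
    8 * (P * (N * N)) + k * (4 * (P * P) + 2 * (P * k)) ∎)
    where
    open ≤-Reasoning
    k = suc c
    N = suc P + c
    N≡ : N ≡ P + k
    N≡ = sym (+-suc P c)
    k≤3P : k ≤ 3 * P
    k≤3P = +-cancelˡ-≤ P _ _ (≤-trans (≤-reflexive (sym N≡)) N≤4P)
    e₁ : ∀ P k → 8 * (P * ((P + k) * (P + k))) + k * k * k ≡ (P + k + P) * ((P + k + P) * (P + k + P)) + k * (4 * (P * P) + 2 * (P * k))
    e₁ = solve-∀
    e₂ : ∀ P k → k * k * (3 * P) ≡ k * (2 * (P * k)) + k * P * k
    e₂ = solve-∀
    e₃ : ∀ P k → k * (2 * (P * k)) + k * P * (3 * P) ≡ k * (3 * (P * P) + 2 * (P * k))
    e₃ = solve-∀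
    k³< : k * k * k < k * (4 * (P * P) + 2 * (P * k))
    k³< = begin-strict
      k * k * k                            ≤⟨ *-monoʳ-≤ (k * k) k≤3P ⟩
      k * k * (3 * P)                      ≡⟨ e₂ P k ⟩
      k * (2 * (P * k)) + k * P * k        ≤⟨ +-monoʳ-≤ (k * (2 * (P * k))) (*-monoʳ-≤ (k * P) k≤3P) ⟩
      k * (2 * (P * k)) + k * P * (3 * P)  ≡⟨ e₃ P k ⟩
      k * (3 * (P * P) + 2 * (P * k))      <⟨ *-monoʳ-< k (+-monoˡ-< (2 * (P * k)) (*-monoˡ-< (P * P) {{>-nonZero (*-mono-≤ 1≤P 1≤P)}} {3} {4} ≤-refl)) ⟩
      k * (4 * (P * P) + 2 * (P * k))      ∎

  -- The difference of the two sides is P (N - P)(4N + P).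
  cube-bound : ∀ {P N} → P ≤ N → (N + P) * ((N + P) * (N + P)) ≤ (N + 7 * P) * (N * N)
  cube-bound {P} P≤N =
    let k , P+k≡N = m≤n⇒∃[o]m+o≡n P≤N in
    subst (λ N → (N + P) * ((N + P) * (N + P)) ≤ (N + 7 * P) * (N * N)) P+k≡N
      (m+o≡n⇒m≤n (P * k * (4 * (P + k) + P)) (lemma P k))
    where
    lemma : ∀ P k → (P + k + P) * ((P + k + P) * (P + k + P)) + P * k * (4 * (P + k) + P)
                  ≡ (P + k + 7 * P) * ((P + k) * (P + k))
    lemma = solve-∀

  -- Three factors N + P go through `cube-bound`, the others through N + P ≤ 2N; then N ≤ (5 + k) P
  -- turns N + 7P into (12 + k) P. This is a crude lower bound for θ (1 - θ)^(3 + k).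
  power-bound : ∀ k {P N} → P ≤ N → N ≤ (5 + k) * P →
                (N + P) ^ (4 + k) ≤ (12 + k) * 2 ^ suc k * (P * N ^ (3 + k))
  power-bound k {P} {N} P≤N N≤ = begin
    (N + P) ^ (4 + k)                                  ≡⟨ e₁ (N + P) ((N + P) ^ suc k) ⟩
    (N + P) * ((N + P) * (N + P)) * (N + P) ^ suc k    ≤⟨ *-mono-≤ (cube-bound P≤N) (^-monoˡ-≤ (suc k) (≤-trans (+-monoʳ-≤ N P≤N) (≤-reflexive (e₂ N)))) ⟩
    (N + 7 * P) * (N * N) * (2 * N) ^ suc k            ≤⟨ *-monoˡ-≤ ((2 * N) ^ suc k) (*-monoˡ-≤ (N * N) (+-monoˡ-≤ (7 * P) N≤)) ⟩
    ((5 + k) * P + 7 * P) * (N * N) * (2 * N) ^ suc k  ≡⟨ cong (((5 + k) * P + 7 * P) * (N * N) *_) (^-distribʳ-* 2 N (suc k)) ⟩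
    ((5 + k) * P + 7 * P) * (N * N) * (2 ^ suc k * N ^ suc k) ≡⟨ e₃ k P N (2 ^ suc k) (N ^ suc k) ⟩
    (12 + k) * 2 ^ suc k * (P * N ^ (3 + k))           ∎
    where
    open ≤-Reasoning
    e₁ : ∀ b x → b * (b * (b * x)) ≡ b * (b * b) * x
    e₁ = solve-∀
    e₂ : ∀ N → N + N ≡ 2 * N
    e₂ = solve-∀
    e₃ : ∀ k P N x y → ((5 + k) * P + 7 * P) * (N * N) * (x * y) ≡ (12 + k) * x * (P * (N * (N * y)))
    e₃ = solve-∀

  -- Blocks of subtractions and the product of their factors

  Sortedℕ : List ℕ → Set
  Sortedℕ = Sorted ≤-totalOrder

  -- A remainder N / P passes to N′ / P′ by subtracting the reciprocals of the
  -- listed numbers, each of which is less than the remainder it leaves.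
  data Block : ℕ → ℕ → List ℕ → ℕ → ℕ → Set where
    []   : ∀ {P N} → Block P N [] P N
    step : ∀ {P N N₁ a D P′ N′} → P < N₁ → N₁ + P ≡ N * a →
           Block (P * a) N₁ D P′ N′ → Block P N (a ∷ D) P′ N′

  Block-∷ʳ : ∀ {P N D P′ N′ N₁ a} → Block P N D P′ N′ → P′ < N₁ → N₁ + P′ ≡ N′ * a →
             Block P N (D ∷ʳ a) (P′ * a) N₁
  Block-∷ʳ []              lt eq = step lt eq []
  Block-∷ʳ (step lt₀ eq₀ B) lt eq = step lt₀ eq₀ (Block-∷ʳ B lt eq)

  m+n≡o*p⇒1≤p : ∀ {m n o p} → 1 ≤ m → m + n ≡ o * p → 1 ≤ p
  m+n≡o*p⇒1≤p {suc m} {n} {o} {zero}  1≤m eq = contradiction (trans eq (*-zeroʳ o)) λ ()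
  m+n≡o*p⇒1≤p {p = suc p} 1≤m eq = s≤s z≤n


  module _ {m c : ℕ} where

    -- N / P is the sum of the reciprocals of D and of N′ / P′ ≤ m / c. By sortedness each
    -- reciprocal is at most 1 / a, and m / c ≤ m / a.
    block-head : ∀ {P N D P′ N′ a} → Block P N D P′ N′ → 1 ≤ P → Sortedℕ (a ∷ D ++ c ∷ []) →
                 c * N′ ≤ m * P′ → a * N ≤ (length D + m) * P
    block-head {N = N} [] 1≤P (a≤c ∷ _) cN≤mP = ≤-trans (*-monoˡ-≤ N a≤c) cN≤mP
    block-head {P} {N} {D = b ∷ D} {a = a} (step {N₁ = N₁} P<N₁ N₁+P≡Nb B) 1≤P (a≤b ∷ b∷D) cN≤mP = begin
      a * N                      ≤⟨ *-monoˡ-≤ N a≤b ⟩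
      b * N                      ≡⟨ *-comm b N ⟩
      N * b                      ≡⟨ N₁+P≡Nb ⟨
      N₁ + P                     ≤⟨ +-monoˡ-≤ P N₁≤ ⟩
      (length D + m) * P + P     ≡⟨ +-comm _ P ⟩
      (suc (length D) + m) * P   ∎
      where
      open ≤-Reasoning
      1≤b : 1 ≤ b
      1≤b = m+n≡o*p⇒1≤p {o = N} (≤-trans (s≤s z≤n) P<N₁) N₁+P≡Nb
      e : ∀ k P b → k * (P * b) ≡ b * (k * P)
      e = solve-∀
      N₁≤ : N₁ ≤ (length D + m) * P
      N₁≤ = *-cancelˡ-≤ b {{>-nonZero 1≤b}}
        (≤-trans (block-head B (*-mono-≤ 1≤P 1≤b) b∷D cN≤mP) (≤-reflexive (e (length D + m) P b)))

    -- This is the lower end of the range of θ = P / (N₁ + P): it amounts to θ ≥ 1 / (1 + d + m),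
    -- where d is the length of D.
    block-remainder : ∀ {P N₁ a D P′ N′} → Block (P * a) N₁ D P′ N′ → 1 ≤ P → 1 ≤ a →
                      Sortedℕ (a ∷ D ++ c ∷ []) → c * N′ ≤ m * P′ → N₁ ≤ (length D + m) * P
    block-remainder {P} {a = a} {D = D} B 1≤P 1≤a sorted cN≤mP = *-cancelˡ-≤ a {{>-nonZero 1≤a}}
      (≤-trans (block-head B (*-mono-≤ 1≤P 1≤a) sorted cN≤mP) (≤-reflexive (e (length D + m) P a)))
      where
      e : ∀ k P b → k * (P * b) ≡ b * (k * P)
      e = solve-∀

  -- Up to the factor 1 + μ, this bounds the inverse of the product of the factors
  -- θ (1 − θ)^e over a block of length d that 1 + μ further entries follow. The
  -- value at d = 2 is sharp, that at d ≥ 3 is not.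
  κ : ℕ → ℕ → ℕ
  κ μ 0                   = suc μ
  κ μ 1                   = (2 + μ) * (2 + μ)
  κ μ 2                   = 8 * ((2 + μ) * (2 + μ))
  κ μ (suc d@(suc (suc k))) = (12 + k) * 2 ^ suc k * κ μ d

  module _ {P N N₁ N′ a f K Y : ℕ} (e : ℕ) (1≤P : 1 ≤ P) (N₁+P≡Na : N₁ + P ≡ N * a) where

    private
      lhs : a ^ suc e * (N ^ suc e * Y) ≡ (N₁ + P) ^ suc e * Y
      lhs = begin
        a ^ suc e * (N ^ suc e * Y)  ≡⟨ e₁ (a ^ suc e) (N ^ suc e) Y ⟩
        N ^ suc e * a ^ suc e * Y    ≡⟨ cong (_* Y) (^-distribʳ-* N a (suc e)) ⟨
        (N * a) ^ suc e * Y          ≡⟨ cong (λ x → x ^ suc e * Y) N₁+P≡Na ⟨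
        (N₁ + P) ^ suc e * Y         ∎
        where
        open ≡-Reasoning
        e₁ : ∀ x y z → x * (y * z) ≡ y * x * z
        e₁ = solve-∀

      rhs : f * P * (K * (N′ * (P * a) ^ suc e)) ≡ a ^ suc e * (f * K * (N′ * P ^ (2 + e)))
      rhs = begin
        f * P * (K * (N′ * (P * a) ^ suc e))       ≡⟨ cong (λ x → f * P * (K * (N′ * x))) (^-distribʳ-* P a (suc e)) ⟩
        f * P * (K * (N′ * (P ^ suc e * a ^ suc e))) ≡⟨ e₁ f P K N′ (P ^ suc e) (a ^ suc e) ⟩
        a ^ suc e * (f * K * (N′ * P ^ (2 + e)))   ∎
        where
        open ≡-Reasoning
        e₁ : ∀ f P K N′ x y → f * P * (K * (N′ * (x * y))) ≡ y * (f * K * (N′ * (P * x)))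
        e₁ = solve-∀

      mid : f * (P * N₁ ^ e) * Y ≡ f * P * (N₁ ^ e * Y)
      mid = e₁ f P (N₁ ^ e) Y
        where
        e₁ : ∀ f P x Y → f * (P * x) * Y ≡ f * P * (x * Y)
        e₁ = solve-∀

    -- Multiplying by a^(e + 1) and replacing N a by N₁ + P splits the claim into θ (1 - θ)^e > 1 /
    -- f for the new head and the bound for the rest of the block. In `prepend-≤-<` the strictness
    -- comes from the rest instead.
    prepend-<-≤ : 1 ≤ Y → (N₁ + P) ^ suc e < f * (P * N₁ ^ e) → N₁ ^ e * Y ≤ K * (N′ * (P * a) ^ suc e) →
                  N ^ suc e * Y < f * K * (N′ * P ^ (2 + e))
    prepend-<-≤ 1≤Y b< IH = *-cancelˡ-< (a ^ suc e) _ _ (begin-strict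
      a ^ suc e * (N ^ suc e * Y)               ≡⟨ lhs ⟩
      (N₁ + P) ^ suc e * Y                      <⟨ *-monoˡ-< Y {{>-nonZero 1≤Y}} b< ⟩
      f * (P * N₁ ^ e) * Y                      ≡⟨ mid ⟩
      f * P * (N₁ ^ e * Y)                      ≤⟨ *-monoʳ-≤ (f * P) IH ⟩
      f * P * (K * (N′ * (P * a) ^ suc e))      ≡⟨ rhs ⟩
      a ^ suc e * (f * K * (N′ * P ^ (2 + e)))  ∎)
      where open ≤-Reasoning

    prepend-≤-< : 1 ≤ f → (N₁ + P) ^ suc e ≤ f * (P * N₁ ^ e) → N₁ ^ e * Y < K * (N′ * (P * a) ^ suc e) →
                  N ^ suc e * Y < f * K * (N′ * P ^ (2 + e))
    prepend-≤-< 1≤f b≤ IH = *-cancelˡ-< (a ^ suc e) _ _ (begin-strict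
      a ^ suc e * (N ^ suc e * Y)               ≡⟨ lhs ⟩
      (N₁ + P) ^ suc e * Y                      ≤⟨ *-monoˡ-≤ Y b≤ ⟩
      f * (P * N₁ ^ e) * Y                      ≡⟨ mid ⟩
      f * P * (N₁ ^ e * Y)                      <⟨ *-monoʳ-< (f * P) {{>-nonZero (*-mono-≤ 1≤f 1≤P)}} IH ⟩
      f * P * (K * (N′ * (P * a) ^ suc e))      ≡⟨ rhs ⟩
      a ^ suc e * (f * K * (N′ * P ^ (2 + e)))  ∎)
      where open ≤-Reasoning

  -- `endpoint-quadratic` bounds θ (1 - θ) below by its value at θ = 1 / (2 + μ). The slack `w` is
  -- kept because it vanishes only at that end point, which later identifies the balanced extremal
  -- lists.
  block-singleton : ∀ {P N N₁ a} μ → P < N₁ → N₁ + P ≡ N * a → N₁ ≤ suc μ * P →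
                    ∃[ w ] N ^ 2 * (suc μ * ((P * a) * (P * a))) + w ≡ κ μ 1 * (N₁ * P ^ 3)
                         × (1 ≤ P → w ≡ 0 → N₁ ≡ suc μ * P)
  block-singleton {P} {N} {N₁} {a} μ P<N₁ N₁+P≡Na N₁≤ =
    let q , N₁+q≡ = m≤n⇒∃[o]m+o≡n N₁≤
        z , 1≤z , eq = endpoint-quadratic μ P<N₁ (sym N₁+q≡)
    in q * z * (P * P) ,
       (begin
         N ^ 2 * (suc μ * ((P * a) * (P * a))) + q * z * (P * P)   ≡⟨ e₁ N (suc μ) P a (q * z) ⟩
         (suc μ * ((N * a) * (N * a)) + q * z) * (P * P)           ≡⟨ cong (λ x → (suc μ * (x * x) + q * z) * (P * P)) N₁+P≡Na ⟨
         (suc μ * ((N₁ + P) * (N₁ + P)) + q * z) * (P * P)         ≡⟨ cong (_* (P * P)) eq ⟩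
         (2 + μ) * (2 + μ) * (P * N₁) * (P * P)                    ≡⟨ e₂ ((2 + μ) * (2 + μ)) P N₁ ⟩
         (2 + μ) * (2 + μ) * (N₁ * P ^ 3)                          ∎) ,
       λ 1≤P w≡0 → trans (sym (+-identityʳ N₁)) (trans (cong (N₁ +_) (sym (q≡0 q z 1≤z 1≤P w≡0))) N₁+q≡)
    where
    open ≡-Reasoning
    e₁ : ∀ N m P a w → N * (N * 1) * (m * ((P * a) * (P * a))) + w * (P * P) ≡ (m * ((N * a) * (N * a)) + w) * (P * P)
    e₁ = solve-∀
    e₂ : ∀ k P N → k * (P * N) * (P * P) ≡ k * (N * (P * (P * (P * 1))))
    e₂ = solve-∀
    q≡0 : ∀ q z → 1 ≤ z → 1 ≤ P → q * z * (P * P) ≡ 0 → q ≡ 0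
    q≡0 zero    z 1≤z 1≤P _  = refl
    q≡0 (suc q) z 1≤z 1≤P eq = contradiction eq (m<n⇒n≢0 (*-mono-≤ (*-mono-≤ (s≤s (z≤n {q})) 1≤z) (*-mono-≤ 1≤P 1≤P)))

  block-product≥1 : ∀ {P N D P′ N′} → Block P N D P′ N′ → 1 ≤ P → 1 ≤ P′
  block-product≥1 [] 1≤P = 1≤P
  block-product≥1 (step {N = N} P<N₁ eq B) 1≤P =
    block-product≥1 B (*-mono-≤ 1≤P (m+n≡o*p⇒1≤p {o = N} (≤-trans (s≤s z≤n) P<N₁) eq))

  -- The factors are collected backwards: `block-singleton` for the last entry, `cube-bound-<` for
  -- the one before it, `power-bound` for all earlier ones. The single strict factor makes the whole
  -- bound strict.
  block-bound : ∀ {P N x y D P′ N′ c} μ → μ ≤ 2 → Block P N (x ∷ y ∷ D) P′ N′ → 1 ≤ P →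
                Sortedℕ (x ∷ y ∷ D ++ c ∷ []) → c * N′ ≤ suc μ * P′ →
                N ^ (3 + length D) * (suc μ * (P′ * P′)) < κ μ (2 + length D) * (N′ * P ^ (4 + length D))
  block-bound {P} {N} {x} {y} {[]} μ μ≤2 B@(step {N₁ = N₁} P<N₁ N₁+P≡Nx B₁@(step {N₁ = N₂} Px<N₂ N₂+Px≡N₁y [])) 1≤P sorted@(_ ∷ sorted₁) cN≤mP =
    prepend-<-≤ {N = N} {N′ = N₂} {a = x} {f = 8} {K = κ μ 1} 2 1≤P N₁+P≡Nx
      (*-mono-≤ (s≤s (z≤n {μ})) (*-mono-≤ 1≤P′ 1≤P′))
      -- Here μ ≤ 2 turns N₁ ≤ (2 + μ) P into the range N₁ ≤ 4P of `cube-bound-<`.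
      (subst₂ _<_ (e₁ (N₁ + P)) (e₂ P N₁) (cube-bound-< 1≤P P<N₁ (≤-trans N₁≤ (*-monoˡ-≤ P (s≤s (s≤s μ≤2))))))
      (let w , eq , _ = block-singleton {N = N₁} {a = y} μ Px<N₂ N₂+Px≡N₁y N₂≤ in m+o≡n⇒m≤n w eq)
    where
    1≤x : 1 ≤ x
    1≤x = m+n≡o*p⇒1≤p {o = N} (≤-trans (s≤s z≤n) P<N₁) N₁+P≡Nx
    1≤y : 1 ≤ y
    1≤y = m+n≡o*p⇒1≤p {o = N₁} (≤-trans (s≤s z≤n) Px<N₂) N₂+Px≡N₁y
    1≤P′ : 1 ≤ P * x * y
    1≤P′ = block-product≥1 B 1≤P
    N₁≤ : N₁ ≤ (2 + μ) * P
    N₁≤ = block-remainder {m = suc μ} B₁ 1≤P 1≤x sorted cN≤mP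
    N₂≤ : N₂ ≤ suc μ * (P * x)
    N₂≤ = block-remainder {m = suc μ} [] (*-mono-≤ 1≤P 1≤x) 1≤y sorted₁ cN≤mP
    e₁ : ∀ b → b * (b * b) ≡ b * (b * (b * 1))
    e₁ = solve-∀
    e₂ : ∀ P N → 8 * (P * (N * N)) ≡ 8 * (P * (N * (N * 1)))
    e₂ = solve-∀
  block-bound {P} {N} {x} {y} {z ∷ D} {P′} {N′} μ μ≤2 (step {N₁ = N₁} P<N₁ N₁+P≡Nx B₁) 1≤P sorted@(_ ∷ sorted₁) cN≤mP =
    prepend-≤-< {N = N} {N′ = N′} {a = x} {f = (12 + length D) * 2 ^ suc (length D)} {K = κ μ (2 + length D)} {Y = suc μ * (P′ * P′)} (3 + length D) 1≤P N₁+P≡Nx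
      (*-mono-≤ (s≤s (z≤n {11 + length D})) (m^n>0 2 (suc (length D))))
      (power-bound (length D) (<⇒≤ P<N₁) (≤-trans N₁≤ (*-monoˡ-≤ P bound)))
      (block-bound μ μ≤2 B₁ (*-mono-≤ 1≤P 1≤x) sorted₁ cN≤mP)
    where
    1≤x : 1 ≤ x
    1≤x = m+n≡o*p⇒1≤p {o = N} (≤-trans (s≤s z≤n) P<N₁) N₁+P≡Nx
    N₁≤ : N₁ ≤ (2 + length D + suc μ) * P
    N₁≤ = block-remainder {m = suc μ} B₁ 1≤P 1≤x sorted cN≤mP
    bound : 2 + length D + suc μ ≤ 5 + length D
    bound = ≤-trans (+-monoʳ-≤ (2 + length D) (s≤s μ≤2)) (≤-reflexive (e (length D)))
      where
      e : ∀ d → 2 + d + 3 ≡ 5 + d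
      e = solve-∀

  -- Growth of the iterates of t ↦ t (t + 1) against the block constants

  τ : ℕ → ℕ → ℕ
  τ t zero    = t
  τ t (suc d) = τ t d * suc (τ t d)

  -- Sharp at t = 1, where the iterates are 1, 2, 6, 42; hence the constant 7 is available only from
  -- t = 2 on.
  6t²≤τ₂ : ∀ {t} → 1 ≤ t → 6 * (t * t) ≤ τ t 2
  6t²≤τ₂ {suc u} _ = m+o≡n⇒m≤n (suc u * (u * (u * u + 5 * u + 3))) (e u)
    where
    e : ∀ u → 6 * (suc u * suc u) + suc u * (u * (u * u + 5 * u + 3)) ≡ suc u * suc (suc u) * suc (suc u * suc (suc u))
    e = solve-∀

  7t²≤τ₂ : ∀ {t} → 2 ≤ t → 7 * (t * t) ≤ τ t 2
  7t²≤τ₂ {suc (suc u)} (s≤s (s≤s _)) = m+o≡n⇒m≤n ((2 + u) * (u * u * u + 8 * (u * u) + 15 * u + 7)) (e u)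
    where
    e : ∀ u → 7 * ((2 + u) * (2 + u)) + (2 + u) * (u * u * u + 8 * (u * u) + 15 * u + 7)
            ≡ (2 + u) * (3 + u) * suc ((2 + u) * (3 + u))
    e = solve-∀

  42t³≤τ₃ : ∀ {t} → 1 ≤ t → 42 * (t * t * t) ≤ τ t 3
  42t³≤τ₃ {t@(suc u)} 1≤t = begin
    42 * (t * t * t)        ≡⟨ e₁ t ⟩
    6 * (t * t) * (7 * t)   ≤⟨ *-mono-≤ (6t²≤τ₂ 1≤t) (≤-trans (m+o≡n⇒m≤n (6 * (u * u) + 5 * u) (e₂ u)) (s≤s (6t²≤τ₂ 1≤t))) ⟩
    τ t 3                   ∎
    where
    open ≤-Reasoning
    e₁ : ∀ t → 42 * (t * t * t) ≡ 6 * (t * t) * (7 * t)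
    e₁ = solve-∀
    e₂ : ∀ u → 7 * suc u + (6 * (u * u) + 5 * u) ≡ suc (6 * (suc u * suc u))
    e₂ = solve-∀

  square-mono : ∀ {m n} → m ≤ n → m * m ≤ n * n
  square-mono m≤n = *-mono-≤ m≤n m≤n

  -- `κ 1 2` is 72 = 2 · 6², which `6t²≤τ₂` meets exactly. Strictness is left to `block-bound`.
  κ₂-bound₁ : ∀ {t} → 1 ≤ t → κ 1 2 * t ^ 4 ≤ 2 * (τ t 2 * τ t 2)
  κ₂-bound₁ {t} 1≤t = ≤-trans (≤-reflexive (e t)) (*-monoʳ-≤ 2 (square-mono (6t²≤τ₂ 1≤t)))
    where
    e : ∀ t → 72 * (t * (t * (t * (t * 1)))) ≡ 2 * (6 * (t * t) * (6 * (t * t)))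
    e = solve-∀

  -- `κ 2 2` is 128, which exceeds 3 · 6² = 108 but not 3 · 7² = 147. The inequality fails at t = 1,
  -- and this failure is the source of the `exceptional` outcome.
  κ₂-bound₂ : ∀ {t} → 2 ≤ t → κ 2 2 * t ^ 4 ≤ 3 * (τ t 2 * τ t 2)
  κ₂-bound₂ {t} 2≤t = begin
    128 * t ^ 4                          ≤⟨ *-monoˡ-≤ (t ^ 4) (m≤m+n 128 19) ⟩
    147 * t ^ 4                          ≡⟨ e t ⟩
    3 * (7 * (t * t) * (7 * (t * t)))    ≤⟨ *-monoʳ-≤ 3 (square-mono (7t²≤τ₂ 2≤t)) ⟩
    3 * (τ t 2 * τ t 2)                  ∎
    where
    open ≤-Reasoning
    e : ∀ t → 147 * (t * (t * (t * (t * 1)))) ≡ 3 * (7 * (t * t) * (7 * (t * t)))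
    e = solve-∀

  -- The constant serves both values of μ: `κ 2 3` is 3 · 1024 and `κ 1 3` is 1728 < 2 · 1024. The
  -- room for it is 42² = 1764.
  1024t⁵≤τ₃² : ∀ {t} → 1 ≤ t → 1024 * t ^ 5 ≤ τ t 3 * τ t 3
  1024t⁵≤τ₃² {t} 1≤t = begin
    1024 * t ^ 5                            ≤⟨ *-mono-≤ (m≤m+n 1024 740) (^-monoʳ-≤ t {{>-nonZero 1≤t}} (m≤m+n 5 1)) ⟩
    1764 * t ^ 6                            ≡⟨ e t ⟩
    42 * (t * t * t) * (42 * (t * t * t))   ≤⟨ square-mono (42t³≤τ₃ 1≤t) ⟩
    τ t 3 * τ t 3                           ∎
    where
    open ≤-Reasoning
    e : ∀ t → 1764 * (t * (t * (t * (t * (t * (t * 1)))))) ≡ 42 * (t * t * t) * (42 * (t * t * t))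
    e = solve-∀

  τ≥1 : ∀ {t} d → 1 ≤ t → 1 ≤ τ t d
  τ≥1 zero    1≤t = 1≤t
  τ≥1 (suc d) 1≤t = *-mono-≤ (τ≥1 d 1≤t) (s≤s (z≤n {τ _ d}))

  -- Passing from length 3 + j to 4 + j multiplies `κ` by (13 + j) 2^(2 + j), the power of t by t
  -- and the square of the iterate T by (T + 1)². The two conjuncts let one factor T + 1 absorb 13 +
  -- j and the other 2^(2 + j) t.
  τ-growth : ∀ {t} j → 1 ≤ t → 13 + j ≤ τ t (3 + j) × 2 ^ (2 + j) * t ≤ τ t (3 + j)
  τ-growth {t} zero 1≤t =
    ≤-trans (≤-trans (m≤m+n 13 29) (*-monoʳ-≤ 42 (*-mono-≤ (*-mono-≤ 1≤t 1≤t) 1≤t))) (42t³≤τ₃ 1≤t) ,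
    ≤-trans (*-mono-≤ (m≤m+n 4 38) (m≤n*m t (t * t) {{>-nonZero (*-mono-≤ 1≤t 1≤t)}})) (42t³≤τ₃ 1≤t)
  τ-growth {t} (suc j) 1≤t = let 13+j≤ , 2^≤ = τ-growth {t} j 1≤t in
    (begin
      14 + j                    ≤⟨ s≤s 13+j≤ ⟩
      suc T                     ≤⟨ m≤n*m (suc T) T {{>-nonZero 1≤T}} ⟩
      T * suc T                 ∎) ,
    (begin
      2 * 2 ^ (2 + j) * t       ≡⟨ *-assoc 2 (2 ^ (2 + j)) t ⟩
      2 * (2 ^ (2 + j) * t)     ≤⟨ *-mono-≤ (s≤s 1≤T) 2^≤ ⟩
      suc T * T                 ≡⟨ *-comm (suc T) T ⟩
      T * suc T                 ∎)
    where
    open ≤-Reasoning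
    T = τ t (3 + j)
    1≤T : 1 ≤ T
    1≤T = τ≥1 (3 + j) 1≤t

  κ-bound : ∀ μ {t} → 1 ≤ t → κ μ 3 * t ^ 5 ≤ suc μ * (τ t 3 * τ t 3) →
            ∀ j → κ μ (3 + j) * t ^ (5 + j) ≤ suc μ * (τ t (3 + j) * τ t (3 + j))
  κ-bound μ     1≤t base zero    = base
  κ-bound μ {t} 1≤t base (suc j) = let 13+j≤ , 2^≤ = τ-growth {t} j 1≤t in begin
    (13 + j) * 2 ^ (2 + j) * K * (t * t ^ (5 + j))           ≡⟨ e₁ (13 + j) (2 ^ (2 + j)) K t (t ^ (5 + j)) ⟩
    (13 + j) * (2 ^ (2 + j) * t) * (K * t ^ (5 + j))         ≤⟨ *-mono-≤ (*-mono-≤ (m≤n⇒m≤1+n 13+j≤) (m≤n⇒m≤1+n 2^≤)) (κ-bound μ 1≤t base j) ⟩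
    (suc T * suc T) * (suc μ * (T * T))                      ≡⟨ e₂ T (suc μ) ⟩
    suc μ * (T * suc T * (T * suc T))                        ∎
    where
    open ≤-Reasoning
    T = τ t (3 + j)
    K = κ μ (3 + j)
    e₁ : ∀ a b K t x → a * b * K * (t * x) ≡ a * (b * t) * (K * x)
    e₁ = solve-∀
    e₂ : ∀ T m → (suc T * suc T) * (m * (T * T)) ≡ m * (T * suc T * (T * suc T))
    e₂ = solve-∀

  -- The condition under which a block of length 2 + d restores the strict inequality at its end, if
  -- the remainder there is at most (1 + μ) / c for the next entry c.
  κ-Dominated : ℕ → ℕ → ℕ → Set
  κ-Dominated μ t d = κ μ (2 + d) * t ^ (4 + d) ≤ suc μ * (τ t (2 + d) * τ t (2 + d))

  κ-bound₁ : ∀ {t} d → 1 ≤ t → κ-Dominated 1 t d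
  κ-bound₁     zero    1≤t = κ₂-bound₁ 1≤t
  κ-bound₁ {t} (suc d) 1≤t = κ-bound 1 1≤t (begin
    1728 * t ^ 5              ≤⟨ *-monoˡ-≤ (t ^ 5) (m≤m+n 1728 320) ⟩
    2048 * t ^ 5              ≡⟨ *-assoc 2 1024 (t ^ 5) ⟩
    2 * (1024 * t ^ 5)        ≤⟨ *-monoʳ-≤ 2 (1024t⁵≤τ₃² 1≤t) ⟩
    2 * (τ t 3 * τ t 3)       ∎) d
    where open ≤-Reasoning

  κ-bound₂ : ∀ {t} d → 1 ≤ t → 2 ≤ t ⊎ 1 ≤ d → κ-Dominated 2 t d
  κ-bound₂     zero    1≤t (inj₁ 2≤t) = κ₂-bound₂ 2≤t
  κ-bound₂ {t} (suc d) 1≤t _          = κ-bound 2 1≤t (begin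
    3072 * t ^ 5              ≡⟨ *-assoc 3 1024 (t ^ 5) ⟩
    3 * (1024 * t ^ 5)        ≤⟨ *-monoʳ-≤ 3 (1024t⁵≤τ₃² 1≤t) ⟩
    3 * (τ t 3 * τ t 3)       ∎) d
    where open ≤-Reasoning

  -- Two factors P use the square inequality and the other d the linear one. This replaces the
  -- powers of P and N at the start of a block by a power of t.
  weak⇒power : ∀ {P N t} → P * P ≤ N * (t * t) → P ≤ N * t → ∀ d → P ^ (2 + d) ≤ N ^ (1 + d) * t ^ (2 + d)
  weak⇒power {P} {N} {t} P²≤Nt² P≤Nt d = begin
    P * (P * P ^ d)                     ≡⟨ *-assoc P P (P ^ d) ⟨
    P * P * P ^ d                       ≤⟨ *-mono-≤ P²≤Nt² (^-monoˡ-≤ d P≤Nt) ⟩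
    N * (t * t) * (N * t) ^ d           ≡⟨ cong (N * (t * t) *_) (^-distribʳ-* N t d) ⟩
    N * (t * t) * (N ^ d * t ^ d)       ≡⟨ e N t (N ^ d) (t ^ d) ⟩
    N * N ^ d * (t * (t * t ^ d))       ∎
    where
    open ≤-Reasoning
    e : ∀ N t x y → N * (t * t) * (x * y) ≡ N * x * (t * (t * y))
    e = solve-∀

  weak⇒power-1-< : ∀ {P N t} → P * P ≤ N * (t * t) → P < N * t → P ^ 3 < N ^ 2 * t ^ 3
  weak⇒power-1-< {P} {N} {t} P²≤Nt² P<Nt = begin-strict
    P * (P * (P * 1))            ≡⟨ e₁ P ⟩
    P * P * P                    ≤⟨ *-monoˡ-≤ P P²≤Nt² ⟩
    N * (t * t) * P              <⟨ *-monoʳ-< (N * (t * t)) {{>-nonZero (positive N t P<Nt)}} P<Nt ⟩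
    N * (t * t) * (N * t)        ≡⟨ e₂ N t ⟩
    N * (N * 1) * (t * (t * (t * 1))) ∎
    where
    open ≤-Reasoning
    e₁ : ∀ P → P * (P * (P * 1)) ≡ P * P * P
    e₁ = solve-∀
    e₂ : ∀ N t → N * (t * t) * (N * t) ≡ N * (N * 1) * (t * (t * (t * 1)))
    e₂ = solve-∀
    positive : ∀ N t → P < N * t → 1 ≤ N * (t * t)
    positive (suc N) (suc t) _ = s≤s z≤n
    positive (suc N) zero lt   = contradiction (≤-trans lt (≤-reflexive (*-zeroʳ N))) λ ()

  -- Sylvester numbers, sorted lists and cancellation

  s≡1+t : ∀ g k → s g (suc k) ≡ suc (t g (suc k))
  s≡1+t g zero    = trans (+-comm g 1) (cong suc (sym (m+n∸n≡m g 1)))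
  s≡1+t g (suc k) = trans (+-comm (x * (x ∸ 1)) 1) (cong suc (sym (m+n∸n≡m (x * (x ∸ 1)) 1)))
    where x = s g (suc k)

  t-1 : ∀ g → t g 1 ≡ g
  t-1 g = m+n∸n≡m g 1

  t-suc : ∀ g k → t g (2 + k) ≡ t g (suc k) * suc (t g (suc k))
  t-suc g k = trans (m+n∸n≡m (x * (x ∸ 1)) 1) (trans (*-comm x (x ∸ 1)) (cong (t g (suc k) *_) (s≡1+t g k)))
    where x = s g (suc k)

  t-+ : ∀ g l d → t g (suc (d + l)) ≡ τ (t g (suc l)) d
  t-+ g l zero    = refl
  t-+ g l (suc d) = trans (t-suc g (d + l)) (cong (λ x → x * suc x) (t-+ g l d))

  sorted-suffix : ∀ xs {ys} → Sortedℕ (xs ++ ys) → Sortedℕ ys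
  sorted-suffix []           sorted       = sorted
  sorted-suffix (x ∷ [])     {[]}    _    = []
  sorted-suffix (x ∷ [])     {_ ∷ _} (_ ∷ sorted) = sorted
  sorted-suffix (x ∷ y ∷ xs) (_ ∷ sorted) = sorted-suffix (y ∷ xs) sorted

  sorted-prefix : ∀ xs {c ys} → Sortedℕ (xs ++ c ∷ ys) → Sortedℕ (xs ++ c ∷ [])
  sorted-prefix []           _            = [-]
  sorted-prefix (x ∷ [])     (x≤c ∷ _)    = x≤c ∷ [-]
  sorted-prefix (x ∷ y ∷ xs) (x≤y ∷ rest) = x≤y ∷ sorted-prefix (y ∷ xs) rest

  square-cancel-< : ∀ {m n} → m * m < n * n → m < n
  square-cancel-< {m} {n} m²<n² with m <? n
  ... | yes m<n = m<n
  ... | no m≮n = contradiction (≤-trans m²<n² (square-mono (≮⇒≥ m≮n))) (<-irrefl refl)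

  square-< : ∀ {P N T} → P * P < N * (T * T) → P < N * T
  square-< {P} {suc n} {T} lt = square-cancel-< (≤-trans lt (m+o≡n⇒m≤n (n * (suc n * (T * T))) (e n T)))
    where
    e : ∀ n T → suc n * (T * T) + n * (suc n * (T * T)) ≡ suc n * T * (suc n * T)
    e = solve-∀

  square-≤ : ∀ {P N T} → 2 ≤ N → 1 ≤ T → P * P ≤ N * (T * T) → P < N * T
  square-≤ {P} {suc (suc n)} {T} (s≤s (s≤s _)) 1≤T le = square-cancel-< (begin-strict
    P * P                     ≤⟨ le ⟩
    (2 + n) * (T * T)         <⟨ m<m*n ((2 + n) * (T * T)) (2 + n) {{>-nonZero (*-mono-≤ (s≤s (z≤n {suc n})) (*-mono-≤ 1≤T 1≤T))}} (s≤s (s≤s z≤n)) ⟩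
    (2 + n) * (T * T) * (2 + n) ≡⟨ e (2 + n) T ⟩
    (2 + n) * T * ((2 + n) * T) ∎)
    where
    open ≤-Reasoning
    e : ∀ n T → n * (T * T) * n ≡ n * T * (n * T)
    e = solve-∀

  power-cancel-≤ : ∀ {N x K Y N′ p q} → 1 ≤ N → N ^ x * Y ≤ K * (N′ * p) → p ≤ N ^ x * q → Y ≤ K * (N′ * q)
  power-cancel-≤ {N} {x} {K} {Y} {N′} {p} {q} 1≤N le p≤ = *-cancelˡ-≤ (N ^ x) {{m^n≢0 N x {{>-nonZero 1≤N}}}} (begin
    N ^ x * Y               ≤⟨ le ⟩
    K * (N′ * p)            ≤⟨ *-monoʳ-≤ K (*-monoʳ-≤ N′ p≤) ⟩
    K * (N′ * (N ^ x * q))  ≡⟨ e K N′ (N ^ x) q ⟩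
    N ^ x * (K * (N′ * q))  ∎)
    where
    open ≤-Reasoning
    e : ∀ K N x q → K * (N * (x * q)) ≡ x * (K * (N * q))
    e = solve-∀

  power-cancel-< : ∀ {N x K Y N′ p q} → N ^ x * Y < K * (N′ * p) → p ≤ N ^ x * q → Y < K * (N′ * q)
  power-cancel-< {N} {x} {K} {Y} {N′} {p} {q} lt p≤ = *-cancelˡ-< (N ^ x) _ _ (begin-strict
    N ^ x * Y               <⟨ lt ⟩
    K * (N′ * p)            ≤⟨ *-monoʳ-≤ K (*-monoʳ-≤ N′ p≤) ⟩
    K * (N′ * (N ^ x * q))  ≡⟨ e K N′ (N ^ x) q ⟩
    N ^ x * (K * (N′ * q))  ∎)
    where
    open ≤-Reasoning
    e : ∀ K N x q → K * (N * (x * q)) ≡ x * (K * (N * q))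
    e = solve-∀

  -- Reciprocal sums as unreduced fractions

  numer : List ℕ → ℕ
  numer []      = 0
  numer (a ∷ A) = product A + a * numer A

  -- Cross-multiplied form of N / P = Σ 1/a over A. Fractions are never reduced, so that P remains g
  -- times the product of the entries already subtracted.
  Remainder : ℕ → ℕ → List ℕ → Set
  Remainder P N A = numer A * P ≡ N * product A

  remainder-∷ : ∀ {P N a A} → All NonZero A → Remainder P N (a ∷ A) →
                ∃[ b ] b + P ≡ N * a × Remainder (P * a) b A
  remainder-∷ {P} {N} {a} {A} A≢0 rem = b , b+P≡Na , sym (+-cancelʳ-≡ (P * product A) _ _ (begin
    b * product A + P * product A            ≡⟨ *-distribʳ-+ (product A) b P ⟨
    (b + P) * product A                      ≡⟨ cong (_* product A) b+P≡Na ⟩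
    N * a * product A                        ≡⟨ *-assoc N a (product A) ⟩
    N * (a * product A)                      ≡⟨ rem ⟨
    (product A + a * numer A) * P            ≡⟨ e (product A) a (numer A) P ⟩
    numer A * (P * a) + P * product A        ∎))
    where
    open ≡-Reasoning
    e : ∀ p a n P → (p + a * n) * P ≡ n * (P * a) + P * p
    e = solve-∀
    P≤Na : P ≤ N * a
    P≤Na = *-cancelʳ-≤ P (N * a) (product A) {{product≢0 A≢0}}
      (≤-trans (m≤n+m (P * product A) (numer A * (P * a)))
               (≤-reflexive (trans (sym (e (product A) a (numer A) P)) (trans rem (sym (*-assoc N a (product A)))))))
    -- No truncation: 1 / a is one of the summands of N / P, whence P ≤ N a.
    b = N * a ∸ P
    b+P≡Na : b + P ≡ N * a
    b+P≡Na = m∸n+n≡m P≤Na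

  remainder-positive : ∀ {P N a A} → All NonZero A → 1 ≤ P → Remainder P N (a ∷ A) → 1 ≤ N
  remainder-positive {P} {suc N} A≢0 1≤P rem = s≤s z≤n
  remainder-positive {P} {zero} {a} {A} A≢0 1≤P rem =
    contradiction rem (m<n⇒n≢0 (*-mono-≤ (≤-trans (>-nonZero⁻¹ (product A) {{product≢0 A≢0}}) (m≤m+n (product A) (a * numer A))) 1≤P))

  numer-bound : ∀ {a A} → Sortedℕ (a ∷ A) → a * numer A ≤ length A * product A
  numer-bound {a} {[]}    _              = ≤-reflexive (*-zeroʳ a)
  numer-bound {a} {b ∷ A} (a≤b ∷ sorted) = begin
    a * (product A + b * numer A)              ≤⟨ *-monoˡ-≤ (product A + b * numer A) a≤b ⟩
    b * (product A + b * numer A)              ≤⟨ *-monoʳ-≤ b (+-monoʳ-≤ (product A) (numer-bound sorted)) ⟩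
    b * (product A + length A * product A)     ≡⟨ e b (product A) (length A) ⟩
    suc (length A) * (b * product A)           ∎
    where
    open ≤-Reasoning
    e : ∀ b p l → b * (p + l * p) ≡ suc l * (b * p)
    e = solve-∀

  -- A first entry different from `a` is larger, which makes the chain of `numer-bound` strict.
  numer-bound-≡ : ∀ {a A} → Sortedℕ (a ∷ A) → All NonZero A → a * numer A ≡ length A * product A →
                  A ≡ replicate (length A) a
  numer-bound-≡ {a} {[]}    _              _           _  = refl
  numer-bound-≡ {a} {b ∷ A} (a≤b ∷ sorted) (b≢0 ∷ A≢0) eq with a ≟ b
  ... | yes refl = cong (a ∷_) (numer-bound-≡ sorted A≢0
    (+-cancelˡ-≡ (product A) _ _ (*-cancelˡ-≡ _ _ a {{b≢0}} (trans eq (e a (product A) (length A))))))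
    where
    e : ∀ b p l → suc l * (b * p) ≡ b * (p + l * p)
    e = solve-∀
  ... | no a≢b = contradiction eq (<⇒≢ (begin-strict
    a * (product A + b * numer A)              <⟨ *-monoˡ-< (product A + b * numer A) {{>-nonZero positive}} (≤∧≢⇒< a≤b a≢b) ⟩
    b * (product A + b * numer A)              ≤⟨ *-monoʳ-≤ b (+-monoʳ-≤ (product A) (numer-bound sorted)) ⟩
    b * (product A + length A * product A)     ≡⟨ e b (product A) (length A) ⟩
    suc (length A) * (b * product A)           ∎))
    where
    open ≤-Reasoning
    e : ∀ b p l → b * (p + l * p) ≡ suc l * (b * p)
    e = solve-∀
    positive : 1 ≤ product A + b * numer A
    positive = ≤-trans (>-nonZero⁻¹ (product A) {{product≢0 A≢0}}) (m≤m+n (product A) _)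

  remainder-bound : ∀ {P N a A} → Sortedℕ (a ∷ A) → All NonZero A → Remainder P N (a ∷ A) →
                    a * N ≤ suc (length A) * P
  remainder-bound {P} {N} {a} {A} sorted A≢0 rem = *-cancelʳ-≤ _ _ (product A) {{product≢0 A≢0}} (begin
    a * N * product A                           ≡⟨ e₁ a N (product A) ⟩
    N * (a * product A)                         ≡⟨ rem ⟨
    (product A + a * numer A) * P               ≤⟨ *-monoˡ-≤ P (+-monoʳ-≤ (product A) (numer-bound sorted)) ⟩
    (product A + length A * product A) * P      ≡⟨ e₂ (product A) (length A) P ⟩
    suc (length A) * P * product A              ∎)
    where
    open ≤-Reasoning
    e₁ : ∀ a N p → a * N * p ≡ N * (a * p)
    e₁ = solve-∀
    e₂ : ∀ p l P → (p + l * p) * P ≡ suc l * P * p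
    e₂ = solve-∀

  remainder-bound-≡ : ∀ {P N a A} → Sortedℕ (a ∷ A) → All NonZero A → 1 ≤ P → Remainder P N (a ∷ A) →
                      a * N ≡ suc (length A) * P → A ≡ replicate (length A) a
  remainder-bound-≡ {P} {N} {a} {A} sorted A≢0 1≤P rem eq = numer-bound-≡ sorted A≢0
    (+-cancelˡ-≡ (product A) _ _ (*-cancelʳ-≡ _ _ P {{>-nonZero 1≤P}} (begin
      (product A + a * numer A) * P               ≡⟨ rem ⟩
      N * (a * product A)                         ≡⟨ e₁ a N (product A) ⟩
      a * N * product A                           ≡⟨ cong (_* product A) eq ⟩
      suc (length A) * P * product A              ≡⟨ e₂ (product A) (length A) P ⟩
      (product A + length A * product A) * P      ∎)))
    where
    open ≡-Reasoning
    e₁ : ∀ a N p → N * (a * p) ≡ a * N * p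
    e₁ = solve-∀
    e₂ : ∀ p l P → suc l * P * p ≡ (p + l * p) * P
    e₂ = solve-∀

  -- Invariants of a prefix and their propagation along the list

  module _ {g : ℕ} (1≤g : 1 ≤ g) where

    t≥1 : ∀ l → 1 ≤ t g (suc l)
    t≥1 zero    = subst (1 ≤_) (sym (t-1 g)) 1≤g
    t≥1 (suc l) = subst (1 ≤_) (sym (t-suc g l)) (*-mono-≤ (t≥1 l) (s≤s (z≤n {t g (suc l)})))

    t≥2 : ∀ l → 2 ≤ t g (2 + l)
    t≥2 l = subst (2 ≤_) (sym (t-suc g l)) (*-mono-≤ (t≥1 l) (s≤s (t≥1 l)))

  -- The inequality P² ≤ N t² is split by its equality case: `greedy` is the Sylvester prefix, `low`
  -- is strict. The index `suc l` excludes `low` for the empty prefix, so that a low status comes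
  -- with t ≥ 2 once g ≥ 1.
  data Status (g : ℕ) : ℕ → List ℕ → ℕ → ℕ → Set where
    greedy : ∀ {l B P N} → B ≡ sylvester g l → P ≡ t g (suc l) → N ≡ 1 → Status g l B P N
    low    : ∀ {l B P N} → P * P < N * (t g (2 + l) * t g (2 + l)) → Status g (suc l) B P N

  status-≤ : ∀ {g l B P N} → Status g l B P N → P * P ≤ N * (t g (suc l) * t g (suc l)) × P ≤ N * t g (suc l)
  status-≤ {g} {l} (greedy _ refl refl) = ≤-reflexive (sym (*-identityˡ _)) , ≤-reflexive (sym (*-identityˡ _))
  status-≤ {g} {suc l} {N = N} (low lt) = <⇒≤ lt , <⇒≤ (square-< {N = N} lt)

  -- After a block of length one starting at t = 2, equality P² = N t² can occur without a Sylvester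
  -- prefix. The second alternative admits this; its strict half is what `close-step` requires.
  Near : ℕ → ℕ → List ℕ → ℕ → ℕ → Set
  Near g l B P N = Status g l B P N ⊎ (P * P ≤ N * (t g (suc l) * t g (suc l)) × P < N * t g (suc l))

  module _ {g l : ℕ} {B : List ℕ} {P N a b : ℕ} (1≤b : 1 ≤ b) (b≤P : b ≤ P) (b+P≡Na : b + P ≡ N * a) where

    private
      advance-low : P * P ≤ N * (t g (suc l) * t g (suc l)) → P < N * t g (suc l) → Status g (suc l) (B ∷ʳ a) (P * a) b
      advance-low P²≤ P< = low (subst (λ T → (P * a) * (P * a) < b * (T * T)) (sym (t-suc g l))
        (close-step {P} {N} {t g (suc l)} {a} {b} P²≤ P< 1≤b b≤P b+P≡Na))

      advance-greedy : B ≡ sylvester g l → P ≡ t g (suc l) → N ≡ 1 → Status g (suc l) (B ∷ʳ a) (P * a) b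
      advance-greedy B≡ P≡ N≡1 with b ≟ 1
      ... | yes b≡1 = greedy
        (trans (cong₂ _∷ʳ_ B≡ (trans (sym 1+P≡a) (trans (cong suc P≡) (sym (s≡1+t g l)))))
               (applyUpTo-∷ʳ (λ i → s g (suc i)) l))
        (trans (cong (P *_) (sym 1+P≡a)) (trans (cong (λ x → x * suc x) P≡) (sym (t-suc g l))))
        b≡1
        where
        1+P≡a : suc P ≡ a
        1+P≡a = trans (cong (_+ P) (sym b≡1)) (trans b+P≡Na (trans (cong (_* a) N≡1) (*-identityˡ a)))
      ... | no b≢1 = low (begin-strict
        (P * a) * (P * a)                         ≡⟨ cong (λ x → P * x * (P * x)) b+P≡a ⟨
        (P * (b + P)) * (P * (b + P))             ≡⟨ e₁ P (b + P) ⟩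
        P * P * ((b + P) * (b + P))               <⟨ *-monoʳ-< (P * P) {{>-nonZero (*-mono-≤ 1≤P 1≤P)}} (square-step-< (≤∧≢⇒< 1≤b (λ eq → b≢1 (sym eq))) b≤P) ⟩
        P * P * (b * (suc P * suc P))             ≡⟨ e₂ P b ⟩
        b * ((P * suc P) * (P * suc P))           ≡⟨ cong (λ x → b * (x * x)) (trans (cong (λ x → x * suc x) P≡) (sym (t-suc g l))) ⟩
        b * (t g (2 + l) * t g (2 + l))           ∎)
        where
        open ≤-Reasoning
        1≤P : 1 ≤ P
        1≤P = ≤-trans 1≤b b≤P
        b+P≡a : b + P ≡ a
        b+P≡a = trans b+P≡Na (trans (cong (_* a) N≡1) (*-identityˡ a))
        e₁ : ∀ P c → (P * c) * (P * c) ≡ P * P * (c * c)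
        e₁ = solve-∀
        e₂ : ∀ P b → P * P * (b * (suc P * suc P)) ≡ b * ((P * suc P) * (P * suc P))
        e₂ = solve-∀

    -- From a Sylvester prefix, b = 1 gives a = P + 1, the next Sylvester number, and b ≥ 2 gives a
    -- strict inequality by `square-step-<`. Everything else goes through `close-step`.
    advance : Near g l B P N → Status g (suc l) (B ∷ʳ a) (P * a) b
    advance (inj₁ (greedy B≡ P≡ N≡1)) = advance-greedy B≡ P≡ N≡1
    advance (inj₁ (low lt))           = advance-low (<⇒≤ lt) (square-< {N = N} lt)
    advance (inj₂ (P²≤ , P<))         = advance-low P²≤ P<

  -- `D` is the block that is still open, possibly empty. `B₀` is the prefix before it, the last
  -- point at which a status is known.
  record State (g l : ℕ) (B : List ℕ) (P N : ℕ) : Set where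
    constructor state
    field
      {l₀ P₀ N₀} : ℕ
      {B₀ D}     : List ℕ
      status     : Status g l₀ B₀ P₀ N₀
      1≤P₀       : 1 ≤ P₀
      block      : Block P₀ N₀ D P N
      B≡B₀++D    : B ≡ B₀ ++ D
      l≡         : l ≡ length D + l₀

  remainder>0 : ∀ {N N₁ P a} → P < N₁ → N₁ + P ≡ N * a → 1 ≤ N
  remainder>0 {suc N} _ _ = s≤s z≤n
  remainder>0 {zero} {N₁} P<N₁ eq = contradiction (≤-trans P<N₁ (≤-trans (m≤m+n N₁ _) (≤-reflexive eq))) λ ()

  -- Three estimates are chained: `block-bound` across the block, `weak⇒power` at its start, and
  -- `κ-Dominated` for the growth of t meanwhile.
  long-block-low : ∀ {g l₀ P N x y D P′ N′ B₀ B c} μ → μ ≤ 2 →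
    κ-Dominated μ (t g (suc l₀)) (length D) →
    Status g l₀ B₀ P N → 1 ≤ P → Block P N (x ∷ y ∷ D) P′ N′ →
    Sortedℕ (x ∷ y ∷ D ++ c ∷ []) → c * N′ ≤ suc μ * P′ → Status g (2 + length D + l₀) B P′ N′
  long-block-low {g} {l₀} {P} {N} {x} {y} {D} {P′} {N′} {c = c} μ μ≤2 κ≤ status 1≤P block sorted cN≤ = low (*-cancelˡ-< (suc μ) _ _ (begin-strict
    suc μ * (P′ * P′)                                 <⟨ power-cancel-< {N} {3 + length D} {κ μ (2 + length D)} {N′ = N′} (block-bound μ μ≤2 block 1≤P sorted cN≤)
                                                           (weak⇒power {P} {N} {t₀} (proj₁ (status-≤ status)) (proj₂ (status-≤ status)) (2 + length D)) ⟩
    κ μ (2 + length D) * (N′ * t₀ ^ (4 + length D))   ≡⟨ e₁ (κ μ (2 + length D)) N′ (t₀ ^ (4 + length D)) ⟩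
    N′ * (κ μ (2 + length D) * t₀ ^ (4 + length D))   ≤⟨ *-monoʳ-≤ N′ κ≤ ⟩
    N′ * (suc μ * (T * T))                            ≡⟨ e₁ N′ (suc μ) (T * T) ⟩
    suc μ * (N′ * (T * T))                            ≡⟨ cong (λ x → suc μ * (N′ * (x * x))) (t-+ g l₀ (2 + length D)) ⟨
    suc μ * (N′ * (T′ * T′))                          ∎))
    where
    open ≤-Reasoning
    t₀ = t g (suc l₀)
    T = τ t₀ (2 + length D)
    T′ = t g (suc (2 + length D + l₀))
    e₁ : ∀ a b c → a * (b * c) ≡ b * (a * c)
    e₁ = solve-∀

  module _ {g l₀ P N N₁ a : ℕ} {B₀ : List ℕ} (μ : ℕ) (status : Status g l₀ B₀ P N) (P<N₁ : P < N₁) (N₁+P≡Na : N₁ + P ≡ N * a)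
           (N₁≤mP : N₁ ≤ suc μ * P) where

    singleton-block-bound : suc μ * ((P * a) * (P * a)) ≤ κ μ 1 * (N₁ * t g (suc l₀) ^ 3)
    singleton-block-bound = power-cancel-≤ {N} {2} {κ μ 1} {N′ = N₁} (remainder>0 {a = a} P<N₁ N₁+P≡Na)
      (let w , eq , _ = block-singleton {N = N} {a = a} μ P<N₁ N₁+P≡Na N₁≤mP in m+o≡n⇒m≤n w eq)
      (weak⇒power {P} {N} (proj₁ (status-≤ status)) (proj₂ (status-≤ status)) 1)

  -- As `κ 1 1` is 9, the claim comes down to 9t ≤ 2 (t + 1)², with difference (2t - 1)(t - 2). It
  -- is an equality at t = 2, hence only `Near`, and fails at t = 1, which `unit-block-low` covers.
  singleton-block-near : ∀ {g l₀ P N N₁ a B₀ B} → Status g l₀ B₀ P N → 1 ≤ P → 2 ≤ t g (suc l₀) →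
    P < N₁ → N₁ + P ≡ N * a → N₁ ≤ 2 * P → Near g (suc l₀) B (P * a) N₁
  singleton-block-near {g} {l₀} {P} {N} {N₁} {a} status 1≤P 2≤t P<N₁ N₁+P≡Na N₁≤2P = inj₂ (Q²≤ , square-≤ (≤-trans (s≤s 1≤P) P<N₁) 1≤T Q²≤)
    where
    open ≤-Reasoning
    T = t g (suc l₀)
    1≤T : 1 ≤ t g (2 + l₀)
    1≤T = subst (1 ≤_) (sym (t-suc g l₀)) (*-mono-≤ (≤-trans (s≤s z≤n) 2≤t) (s≤s (z≤n {T})))
    9t≤ : ∀ {t} → 2 ≤ t → 9 * t ≤ 2 * (suc t * suc t)
    9t≤ {suc (suc u)} (s≤s (s≤s _)) = m+o≡n⇒m≤n (u * (2 * u + 3)) (e u)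
      where
      e : ∀ u → 9 * (2 + u) + u * (2 * u + 3) ≡ 2 * ((3 + u) * (3 + u))
      e = solve-∀
    e₁ : ∀ N t → 9 * (N * (t * (t * (t * 1)))) ≡ N * (t * t) * (9 * t)
    e₁ = solve-∀
    e₂ : ∀ N t → N * (t * t) * (2 * (suc t * suc t)) ≡ 2 * (N * (t * suc t * (t * suc t)))
    e₂ = solve-∀
    Q²≤ : P * a * (P * a) ≤ N₁ * (t g (2 + l₀) * t g (2 + l₀))
    Q²≤ = *-cancelˡ-≤ 2 (begin
      2 * (P * a * (P * a))                ≤⟨ singleton-block-bound 1 status P<N₁ N₁+P≡Na N₁≤2P ⟩
      9 * (N₁ * T ^ 3)                     ≡⟨ e₁ N₁ T ⟩
      N₁ * (T * T) * (9 * T)               ≤⟨ *-monoʳ-≤ (N₁ * (T * T)) (9t≤ 2≤t) ⟩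
      N₁ * (T * T) * (2 * (suc T * suc T)) ≡⟨ e₂ N₁ T ⟩
      2 * (N₁ * (T * suc T * (T * suc T))) ≡⟨ cong (λ x → 2 * (N₁ * (x * x))) (t-suc g l₀) ⟨
      2 * (N₁ * (t g (2 + l₀) * t g (2 + l₀))) ∎)

  -- For g = 1 a block consisting of α₁ alone can only be closed by (α₁, α₂) = (3, 3).
  unit-block-low : ∀ {g l₀ P₀ N₀ B₀ B x N a b} → 1 ≤ g → Status g l₀ B₀ P₀ N₀ → t g (suc l₀) ≡ 1 →
    P₀ < N → N + P₀ ≡ N₀ * x → N ≤ 2 * P₀ → x ≤ a → a * N ≤ 2 * (P₀ * x) → b + P₀ * x ≡ N * a →
    Status g (2 + l₀) B (P₀ * x * a) b
  unit-block-low {g} {suc l₀} 1≤g (low _) t≡1 = contradiction t≡1 (>⇒≢ (t≥2 1≤g l₀))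
  unit-block-low {g} {l₀} {x = x} {N} {a} {b} 1≤g (greedy _ P₀≡ refl) t≡1 P₀<N N+P₀≡ N≤ x≤a aN≤ b+P≡
    with refl ← trans P₀≡ t≡1
    with refl ← ≤-antisym N≤ P₀<N
    with refl ← trans N+P₀≡ (*-identityˡ x)
    with refl ← ≤-antisym x≤a (*-cancelʳ-≤ a 3 2 aN≤)
    with refl ← +-cancelʳ-≡ 3 b 3 b+P≡
    -- The new P is 1 · 3 · 3 = 9 with b = 3, and the inequality is 81 < 3 · 6² = 108.
    = low (subst (λ T → 81 < 3 * (T * T)) (sym T≡6) (m≤m+n 82 26))
    where
    T≡6 : t g (3 + l₀) ≡ 6
    T≡6 = trans (t-+ g l₀ 2) (cong (λ t → τ t 2) t≡1)

  module _ {g : ℕ} (1≤g : 1 ≤ g) where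

    -- Because b ≤ P, the remainder before `a` is at most 2 / a: the block ends as if two entries
    -- followed, that is with μ = 1. The block is settled first and `a` is then added by `advance`,
    -- except that a block of length one at t = 1 is settled together with `a`.
    close : ∀ {l B P N a b} → State g l B P N → 1 ≤ b → b ≤ P → b + P ≡ N * a → Sortedℕ (B ∷ʳ a) →
            Status g (suc l) (B ∷ʳ a) (P * a) b
    close {l} {B} {P} {N} {a} {b} (state {l₀} {P₀} {N₀} {B₀} {D} status 1≤P₀ block B≡ l≡) 1≤b b≤P b+P≡Na sortedB =
      go D block refl l≡ (sorted-suffix B₀ (subst Sortedℕ (trans (cong (_∷ʳ a) B≡) (++-assoc B₀ D (a ∷ []))) sortedB))
      where
      aN≤2P : a * N ≤ 2 * P
      aN≤2P = ≤-trans (≤-reflexive (trans (*-comm a N) (sym b+P≡Na)))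
                (≤-trans (+-monoˡ-≤ P b≤P) (≤-reflexive (cong (P +_) (sym (+-identityʳ P)))))

      go : ∀ D′ → Block P₀ N₀ D′ P N → D ≡ D′ → l ≡ length D′ + l₀ → Sortedℕ (D′ ∷ʳ a) → Status g (suc l) (B ∷ʳ a) (P * a) b
      go [] [] refl refl sorted = advance 1≤b b≤P b+P≡Na (inj₁ (subst (λ B → Status g l₀ B P N) (trans (sym (++-identityʳ B₀)) (sym B≡)) status))
      go (x ∷ []) (step P₀<N N+P₀≡N₀x []) refl refl (x≤a ∷ sorted) with t g (suc l₀) ≟ 1
      ... | yes t≡1 = unit-block-low 1≤g status t≡1 P₀<N N+P₀≡N₀x N≤2P₀ x≤a aN≤2P b+P≡Na
        where
        N≤2P₀ : N ≤ 2 * P₀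
        N≤2P₀ = block-remainder {m = 2} [] 1≤P₀ (m+n≡o*p⇒1≤p {o = N₀} (≤-trans (s≤s z≤n) P₀<N) N+P₀≡N₀x) (x≤a ∷ sorted) aN≤2P
      ... | no t≢1 = advance 1≤b b≤P b+P≡Na (singleton-block-near status 1≤P₀ (≤∧≢⇒< (t≥1 1≤g l₀) (λ eq → t≢1 (sym eq))) P₀<N N+P₀≡N₀x N≤2P₀)
        where
        N≤2P₀ : N ≤ 2 * P₀
        N≤2P₀ = block-remainder {m = 2} [] 1≤P₀ (m+n≡o*p⇒1≤p {o = N₀} (≤-trans (s≤s z≤n) P₀<N) N+P₀≡N₀x) (x≤a ∷ sorted) aN≤2P
      go (x ∷ y ∷ D′) block refl refl sorted = advance 1≤b b≤P b+P≡Na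
        (inj₁ (long-block-low {D = D′} 1 (s≤s z≤n) (κ-bound₁ (length D′) (t≥1 1≤g l₀)) status 1≤P₀ block sorted aN≤2P))

    extend : ∀ {l B P N a b} → State g l B P N → 1 ≤ P → 1 ≤ a → 1 ≤ b → b + P ≡ N * a → Sortedℕ (B ∷ʳ a) →
             State g (suc l) (B ∷ʳ a) (P * a) b
    extend {l} {B} {P} {N} {a} {b} σ 1≤P 1≤a 1≤b b+P≡Na sorted with b ≤? P
    ... | yes b≤P = state (close σ 1≤b b≤P b+P≡Na sorted) (*-mono-≤ 1≤P 1≤a) [] (sym (++-identityʳ (B ∷ʳ a))) refl
    ... | no b≰P  = let open State σ in
      state status 1≤P₀ (Block-∷ʳ block (≰⇒> b≰P) b+P≡Na)
        (trans (cong (_∷ʳ a) B≡B₀++D) (++-assoc B₀ D (a ∷ [])))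
        (trans (cong suc l≡) (cong (_+ l₀) (sym (trans (length-++ D) (+-comm (length D) 1)))))

    run : ∀ E {c A l B P N} → State g l B P N → 1 ≤ P → Remainder P N (E ++ c ∷ A) → All NonZero (E ++ c ∷ A) →
          Sortedℕ (B ++ E ++ c ∷ A) →
          ∃[ P′ ] ∃[ N′ ] State g (length E + l) (B ++ E) P′ N′ × Remainder P′ N′ (c ∷ A) × 1 ≤ P′ × P′ ≡ P * product E
    run [] {B = B} {P} {N} σ 1≤P rem A≢0 sorted =
      P , N , subst (λ B → State g _ B P N) (sym (++-identityʳ B)) σ , rem , 1≤P , sym (*-identityʳ P)
    run (a ∷ E) {c} {A} {l} {B} {P} {N} σ 1≤P rem (a≢0 ∷ A≢0) sorted =
      let b , b+P≡Na , rem′ = remainder-∷ {N = N} {a} A≢0 rem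
          1≤a = >-nonZero⁻¹ a {{a≢0}}
          1≤Pa = *-mono-≤ 1≤P 1≤a
          1≤b = positive E A≢0 1≤Pa rem′
          P′ , N′ , σ′ , rem″ , 1≤P′ , P′≡ = run E (extend σ 1≤P 1≤a 1≤b b+P≡Na (sorted-prefix B sorted)) 1≤Pa rem′ A≢0
                                    (subst Sortedℕ (sym (∷ʳ-++ B a (E ++ c ∷ A))) sorted)
      in P′ , N′ , subst₂ (λ l B → State g l B P′ N′) (+-suc (length E) l) (∷ʳ-++ B a E) σ′ , rem″ , 1≤P′ ,
         trans P′≡ (*-assoc P a (product E))
      where
      positive : ∀ E {P N} → All NonZero (E ++ c ∷ A) → 1 ≤ P → Remainder P N (E ++ c ∷ A) → 1 ≤ N
      positive []      (_ ∷ A≢0) = remainder-positive {a = c} A≢0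
      positive (x ∷ _) (_ ∷ A≢0) = remainder-positive {a = x} A≢0

  -- Comparison of rational numbers by cross-multiplication

  /-mono-* : ∀ a b c d .{{_ : NonZero b}} .{{_ : NonZero d}} → a * d ≤ c * b → (ℤ.+ a / b) ℚ.≤ (ℤ.+ c / d)
  /-mono-* a (suc b) c (suc d) le = ℚ.toℚᵘ-cancel-≤
    (ℚᵘ.≤-respˡ-≃ (ℚᵘ.≃-sym (ℚ.toℚᵘ-fromℚᵘ (mkℚᵘ (ℤ.+ a) b)))
    (ℚᵘ.≤-respʳ-≃ (ℚᵘ.≃-sym (ℚ.toℚᵘ-fromℚᵘ (mkℚᵘ (ℤ.+ c) d)))
    (*≤* (subst₂ ℤ._≤_ (ℤ.pos-* a (suc d)) (ℤ.pos-* c (suc b)) (ℤ.+≤+ le)))))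

  /-cong-* : ∀ a b c d .{{_ : NonZero b}} .{{_ : NonZero d}} → a * d ≡ c * b → ℤ.+ a / b ≡ ℤ.+ c / d
  /-cong-* a (suc b) c (suc d) eq = ℚ.fromℚᵘ-cong {mkℚᵘ (ℤ.+ a) b} {mkℚᵘ (ℤ.+ c) d}
    (*≡* (trans (sym (ℤ.pos-* a (suc d))) (trans (cong ℤ.+_ eq) (ℤ.pos-* c (suc b)))))

  /-injective-* : ∀ a b c d .{{_ : NonZero b}} .{{_ : NonZero d}} → ℤ.+ a / b ≡ ℤ.+ c / d → a * d ≡ c * b
  /-injective-* a (suc b) c (suc d) eq with ℚ.fromℚᵘ-injective {mkℚᵘ (ℤ.+ a) b} {mkℚᵘ (ℤ.+ c) d} eq
  ... | *≡* e = ℤ.+-injective (trans (ℤ.pos-* a (suc d)) (trans e (sym (ℤ.pos-* c (suc b)))))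

  1/a+n/p : ∀ a n p .{{_ : NonZero a}} .{{_ : NonZero p}} .{{_ : NonZero (a * p)}} →
            (ℤ.+ 1 / a) ℚ.+ (ℤ.+ n / p) ≡ ℤ.+ (p + a * n) / (a * p)
  1/a+n/p (suc a) n (suc p) = ℚ.toℚᵘ-injective (begin
    toℚᵘ ((ℤ.+ 1 / suc a) ℚ.+ (ℤ.+ n / suc p))           ≈⟨ ℚ.toℚᵘ-homo-+ (ℤ.+ 1 / suc a) (ℤ.+ n / suc p) ⟩
    toℚᵘ (ℤ.+ 1 / suc a) ℚᵘ.+ toℚᵘ (ℤ.+ n / suc p)       ≈⟨ ℚᵘ.+-cong (ℚ.toℚᵘ-fromℚᵘ (mkℚᵘ (ℤ.+ 1) a)) (ℚ.toℚᵘ-fromℚᵘ (mkℚᵘ (ℤ.+ n) p)) ⟩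
    mkℚᵘ (ℤ.+ 1) a ℚᵘ.+ mkℚᵘ (ℤ.+ n) p                    ≡⟨ cong (λ i → mkℚᵘ i (p + a * suc p)) e ⟩
    mkℚᵘ (ℤ.+ (suc p + suc a * n)) (p + a * suc p)     ≈⟨ ℚ.toℚᵘ-fromℚᵘ (mkℚᵘ (ℤ.+ (suc p + suc a * n)) (p + a * suc p)) ⟨
    toℚᵘ (ℤ.+ (suc p + suc a * n) / (suc a * suc p))   ∎)
    where
    open ℚᵘ.≃-Reasoning
    e : ℤ.+ 1 ℤ.* ℤ.+ suc p ℤ.+ ℤ.+ n ℤ.* ℤ.+ suc a ≡ ℤ.+ (suc p + suc a * n)
    e = trans (cong₂ ℤ._+_ (ℤ.*-identityˡ (ℤ.+ suc p)) (trans (sym (ℤ.pos-* n (suc a))) (cong ℤ.+_ (*-comm n (suc a)))))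
              (sym (ℤ.pos-+ (suc p) (suc a * n)))

  reciprocalSum-numer : ∀ A (A≢0 : All NonZero A) → reciprocalSum A A≢0 ≡ _/_ (ℤ.+ numer A) (product A) {{product≢0 A≢0}}
  reciprocalSum-numer []      []          = refl
  reciprocalSum-numer (a ∷ A) (a≢0 ∷ A≢0) = trans
    (cong (_/_ (ℤ.+ 1) a {{a≢0}} ℚ.+_) (reciprocalSum-numer A A≢0))
    (1/a+n/p a (numer A) (product A) {{a≢0}} {{product≢0 A≢0}} {{product≢0 (a≢0 ∷ A≢0)}})

  reciprocalSum⇒remainder : ∀ {g A} .{{_ : NonZero g}} (A≢0 : All NonZero A) → reciprocalSum A A≢0 ≡ ℤ.+ 1 / g → Remainder g 1 A
  reciprocalSum⇒remainder {g} {A} A≢0 eq =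
    /-injective-* (numer A) (product A) 1 g {{product≢0 A≢0}} (trans (sym (reciprocalSum-numer A A≢0)) eq)

  -- Least common multiples and the extremal lists

  ∣lcms : ∀ A → All (_∣ lcms A) A
  ∣lcms []      = []
  ∣lcms (a ∷ A) = m∣lcm[m,n] a (lcms A) ∷ All.map (λ x∣ → ∣-trans x∣ (n∣lcm[m,n] a (lcms A))) (∣lcms A)

  lcms-least : ∀ {A c} → All (_∣ c) A → lcms A ∣ c
  lcms-least []         = 1∣ _
  lcms-least (a∣c ∷ A∣c) = lcm-least a∣c (lcms-least A∣c)

  product-≤ : ∀ {A L} → All (_≤ L) A → product A ≤ L ^ length A
  product-≤ []          = ≤-refl
  product-≤ (a≤L ∷ A≤L) = *-mono-≤ a≤L (product-≤ A≤L)

  product-replicate : ∀ k c → product (replicate k c) ≡ c ^ k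
  product-replicate zero    c = refl
  product-replicate (suc k) c = cong (c *_) (product-replicate k c)

  sylvester-∷ʳ : ∀ g l → sylvester g l ∷ʳ s g (suc l) ≡ sylvester g (suc l)
  sylvester-∷ʳ g = applyUpTo-∷ʳ (λ i → s g (suc i))

  -- The product telescopes, since each t times the corresponding s is the next t, starting from
  -- t_{g,1} = g.
  product-sylvester : ∀ g l → g * product (sylvester g l) ≡ t g (suc l)
  product-sylvester g zero    = trans (*-identityʳ g) (sym (t-1 g))
  product-sylvester g (suc l) = begin
    g * product (sylvester g (suc l))                       ≡⟨ cong (λ A → g * product A) (sylvester-∷ʳ g l) ⟨
    g * product (sylvester g l ∷ʳ s g (suc l))              ≡⟨ cong (g *_) (product-++ (sylvester g l) (s g (suc l) ∷ [])) ⟩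
    g * (product (sylvester g l) * (s g (suc l) * 1))       ≡⟨ cong (λ x → g * (product (sylvester g l) * x)) (*-identityʳ (s g (suc l))) ⟩
    g * (product (sylvester g l) * s g (suc l))             ≡⟨ *-assoc g _ _ ⟨
    g * product (sylvester g l) * s g (suc l)               ≡⟨ cong₂ _*_ (product-sylvester g l) (s≡1+t g l) ⟩
    t g (suc l) * suc (t g (suc l))                         ≡⟨ t-suc g l ⟨
    t g (2 + l)                                             ∎
    where open ≡-Reasoning

  s∣t : ∀ g l {i} → i < l → s g (suc i) ∣ t g (suc l)
  s∣t g (suc l) {i} i<1+l = subst (s g (suc i) ∣_) (sym (t-suc g l)) (go (m≤n⇒m<n∨m≡n (s≤s⁻¹ i<1+l)))
    where
    go : i < l ⊎ i ≡ l → s g (suc i) ∣ t g (suc l) * suc (t g (suc l))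
    go (inj₁ i<l)  = ∣-trans (s∣t g l i<l) (m∣m*n _)
    go (inj₂ refl) = subst (s g (suc i) ∣_) (cong (t g (suc i) *_) (s≡1+t g i)) (n∣m*n (t g (suc i)))

  -- (s_{g,1}, …, s_{g,l}, k t_{g,l+1}, …, k t_{g,l+1}) with k repeated entries.
  extremal : ℕ → ℕ → ℕ → List ℕ
  extremal g l k = sylvester g l ++ replicate k (k * t g (suc l))

  product-extremal : ∀ g l k → g * product (extremal g l k) ≡ t g (suc l) * (k * t g (suc l)) ^ k
  product-extremal g l k = begin
    g * product (extremal g l k)                            ≡⟨ cong (g *_) (product-++ (sylvester g l) _) ⟩
    g * (product (sylvester g l) * product (replicate k c)) ≡⟨ *-assoc g _ _ ⟨
    g * product (sylvester g l) * product (replicate k c)   ≡⟨ cong₂ _*_ (product-sylvester g l) (product-replicate k c) ⟩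
    t g (suc l) * c ^ k                                     ∎
    where
    open ≡-Reasoning
    c = k * t g (suc l)

  -- Every Sylvester entry divides t_{g,l+1}, so the repeated entry is a common multiple that itself
  -- belongs to the list.
  lcms-extremal : ∀ g l k → lcms (extremal g l (suc k)) ≡ suc k * t g (suc l)
  lcms-extremal g l k = ∣-antisym
    (lcms-least (All.++⁺ (All.applyUpTo⁺₁ (λ i → s g (suc i)) l (λ i<l → ∣n⇒∣m*n (suc k) (s∣t g l i<l))) (All.replicate⁺ (suc k) ∣-refl)))
    (All.head (All.++⁻ʳ (sylvester g l) (∣lcms (extremal g l (suc k)))))

  -- Bounds for the leading product X = P c with their equality cases

  module _ {P N c : ℕ} (μ : ℕ) (cN≤mP : c * N ≤ suc μ * P) where

    leading-≤ : N * (P * c) ≤ suc μ * (P * P)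
    leading-≤ = begin
      N * (P * c)        ≡⟨ e₁ N P c ⟩
      P * (c * N)        ≤⟨ *-monoʳ-≤ P cN≤mP ⟩
      P * (suc μ * P)    ≡⟨ e₂ P (suc μ) ⟩
      suc μ * (P * P)    ∎
      where
      open ≤-Reasoning
      e₁ : ∀ N P c → N * (P * c) ≡ P * (c * N)
      e₁ = solve-∀
      e₂ : ∀ P m → P * (m * P) ≡ m * (P * P)
      e₂ = solve-∀

    -- The factor N in `leading-≤` cancels against the one in P² ≤ N t². A low status makes this
    -- strict, so equality leaves only the Sylvester prefix, where N = 1 and P = t determine c.
    status-bound : ∀ {g l B} → 1 ≤ g → Status g l B P N → P * c ≤ suc μ * (t g (suc l) * t g (suc l)) ×
                   (P * c ≡ suc μ * (t g (suc l) * t g (suc l)) → B ≡ sylvester g l × c ≡ suc μ * t g (suc l) × c * N ≡ suc μ * P)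
    status-bound {g} {suc l} _ (low lt) = <⇒≤ Pc< , λ eq → contradiction eq (<⇒≢ Pc<)
      where
      open ≤-Reasoning
      T = t g (2 + l)
      e : ∀ m N T → m * (N * (T * T)) ≡ N * (m * (T * T))
      e = solve-∀
      Pc< : P * c < suc μ * (T * T)
      Pc< = *-cancelˡ-< N _ _ (begin-strict
        N * (P * c)               ≤⟨ leading-≤ ⟩
        suc μ * (P * P)           <⟨ *-monoʳ-< (suc μ) lt ⟩
        suc μ * (N * (T * T))     ≡⟨ e (suc μ) N T ⟩
        N * (suc μ * (T * T))     ∎)
    status-bound {g} {l} 1≤g (greedy B≡ refl refl) =
      ≤-trans (≤-reflexive (sym (*-identityˡ (T * c)))) leading-≤ , λ eq →
      let c≡ = *-cancelˡ-≡ c (suc μ * T) T {{>-nonZero (t≥1 1≤g l)}} (trans eq (e (suc μ) T))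
      in B≡ , c≡ , trans (*-identityʳ c) c≡
      where
      T = t g (suc l)
      e : ∀ m T → m * (T * T) ≡ T * (m * T)
      e = solve-∀

    -- This is for a block of length one still open at `c`. In the equality case a low start is
    -- ruled out by `weak⇒power-1-<`; from a Sylvester start the slack of `block-singleton` must
    -- vanish, which determines N, then a, then c.
    singleton-bound : ∀ {g l₀ B₀ P₀ N₀ a} → 1 ≤ N → Status g l₀ B₀ P₀ N₀ → 1 ≤ P₀ → P₀ < N → N + P₀ ≡ N₀ * a → P ≡ P₀ * a →
      a ≤ c → N ≤ suc μ * P₀ →
      P * c ≤ κ μ 1 * t g (suc l₀) ^ 3 ×
      (P * c ≡ κ μ 1 * t g (suc l₀) ^ 3 →
       B₀ ≡ sylvester g l₀ × a ≡ (2 + μ) * t g (suc l₀) × c ≡ (2 + μ) * t g (suc l₀) × c * N ≡ suc μ * P)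
    singleton-bound {g} {l₀} {B₀} {P₀} {N₀} {a} 1≤N status 1≤P₀ P₀<N N+P₀≡ refl a≤c N≤mP₀ =
      *-cancelˡ-≤ N {{>-nonZero 1≤N}} (≤-trans leading-≤ (≤-trans (singleton-block-bound {a = a} μ status P₀<N N+P₀≡ N≤mP₀) (≤-reflexive (e₄ (κ μ 1) N (t₀ ^ 3))))) ,
      equality status
      where
      t₀ = t g (suc l₀)
      e₄ : ∀ k N x → k * (N * x) ≡ N * (k * x)
      e₄ = solve-∀
      equality : Status g l₀ B₀ P₀ N₀ → P₀ * a * c ≡ κ μ 1 * t₀ ^ 3 →
                 B₀ ≡ sylvester g l₀ × a ≡ (2 + μ) * t₀ × c ≡ (2 + μ) * t₀ × c * N ≡ suc μ * (P₀ * a)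
      equality st@(low lt) eq = contradiction eq (<⇒≢ (*-cancelˡ-< (N₀ ^ 2 * N) _ _ (begin-strict
        N₀ ^ 2 * N * (P * c)                    ≡⟨ *-assoc (N₀ ^ 2) N (P * c) ⟩
        N₀ ^ 2 * (N * (P * c))                  ≤⟨ *-monoʳ-≤ (N₀ ^ 2) leading-≤ ⟩
        N₀ ^ 2 * (suc μ * (P * P))              ≤⟨ (let w , eq , _ = block-singleton {N = N₀} {a = a} μ P₀<N N+P₀≡ N≤mP₀ in m+o≡n⇒m≤n w eq) ⟩
        κ μ 1 * (N * P₀ ^ 3)                    <⟨ *-monoʳ-< (κ μ 1) (*-monoʳ-< N {{>-nonZero 1≤N}} (weak⇒power-1-< {P₀} {N₀} {t₀} (<⇒≤ lt) (square-< {N = N₀} lt))) ⟩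
        κ μ 1 * (N * (N₀ ^ 2 * t₀ ^ 3))         ≡⟨ e₆ (κ μ 1) N (N₀ ^ 2) (t₀ ^ 3) ⟩
        N₀ ^ 2 * N * (κ μ 1 * t₀ ^ 3)           ∎)))
        where
        open ≤-Reasoning
        e₆ : ∀ k N x y → k * (N * (x * y)) ≡ x * N * (k * y)
        e₆ = solve-∀
      equality (greedy B₀≡ refl refl) eq =
        let w , bound , N≡ = block-singleton {N = 1} {a = a} μ P₀<N N+P₀≡ N≤mP₀
            -- The slack `w` is squeezed out: under `eq`, `leading-≤` leads back to the same term
            -- without `w`.
            N≡mP₀ = N≡ 1≤P₀ (n≤0⇒n≡0 (+-cancelˡ-≤ (suc μ * (P * P)) _ _ (begin
              suc μ * (P * P) + w                 ≡⟨ cong (_+ w) (*-identityˡ (suc μ * (P * P))) ⟨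
              1 * (suc μ * (P * P)) + w           ≡⟨ bound ⟩
              κ μ 1 * (N * t₀ ^ 3)                ≡⟨ e₄ (κ μ 1) N (t₀ ^ 3) ⟩
              N * (κ μ 1 * t₀ ^ 3)                ≡⟨ cong (N *_) eq ⟨
              N * (P * c)                         ≤⟨ leading-≤ ⟩
              suc μ * (P * P)                     ≡⟨ +-identityʳ _ ⟨
              suc μ * (P * P) + 0                 ∎)))
            a≡ = trans (sym (trans N+P₀≡ (*-identityˡ a))) (trans (cong (_+ t₀) N≡mP₀) (+-comm (suc μ * t₀) t₀))
            -- With N = (1 + μ) P₀ and P = P₀ a, the hypothesis c N ≤ (1 + μ) P reduces to c ≤ a.
            c≤a = *-cancelʳ-≤ c a (suc μ * t₀) {{>-nonZero (*-mono-≤ (s≤s (z≤n {μ})) 1≤P₀)}}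
                    (subst (λ N → c * N ≤ a * (suc μ * t₀)) N≡mP₀ (≤-trans cN≤mP (≤-reflexive (e₇ (suc μ) t₀ a))))
            c≡a = ≤-antisym c≤a a≤c
        in B₀≡ , a≡ , trans c≡a a≡ , trans (cong₂ _*_ c≡a N≡mP₀) (sym (e₇ (suc μ) t₀ a))
        where
        open ≤-Reasoning
        e₇ : ∀ m t a → m * (t * a) ≡ a * (m * t)
        e₇ = solve-∀

  -- The outcome depends on the block open before the last 1 + μ entries: none or a long one gives
  -- `regular`, length one gives `balanced`, and length two at t = 1 with μ = 2 gives `exceptional`.
  -- There 128 is `κ 2 2`; as the bound is strict, no equality case is recorded.
  data Bounded (g r μ : ℕ) (A : List ℕ) (X : ℕ) : Set where
    regular     : X ≤ suc μ * (t g (suc r) * t g (suc r)) →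
                  (X ≡ suc μ * (t g (suc r) * t g (suc r)) → A ≡ extremal g r (suc μ)) → Bounded g r μ A X
    balanced    : ∀ {l} → r ≡ suc l → X ≤ κ μ 1 * t g (suc l) ^ 3 →
                  (X ≡ κ μ 1 * t g (suc l) ^ 3 → A ≡ extremal g l (2 + μ)) → Bounded g r μ A X
    exceptional : μ ≡ 2 → r ≡ 2 → g ≡ 1 → X < 128 → Bounded g r μ A X

  module _ {g : ℕ} (1≤g : 1 ≤ g) where

    t≡1⇒ : ∀ l → t g (suc l) ≡ 1 → l ≡ 0 × g ≡ 1
    t≡1⇒ zero    eq = refl , trans (sym (t-1 g)) eq
    t≡1⇒ (suc l) eq = contradiction eq (>⇒≢ (t≥2 1≤g l))

    t≥6 : ∀ l → 6 ≤ t g (3 + l)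
    t≥6 l = subst (6 ≤_) (sym (t-suc g (suc l))) (*-mono-≤ (t≥2 1≤g l) (s≤s (t≥2 1≤g l)))

    t-2 : t g 2 ≡ g * suc g
    t-2 = trans (t-suc g 0) (cong (λ x → x * suc x) (t-1 g))

    bounded : ∀ {l B P N c tail} μ → 1 ≤ μ → μ ≤ 2 → State g l B P N → length tail ≡ μ → 1 ≤ P →
              All NonZero (c ∷ tail) → Remainder P N (c ∷ tail) → Sortedℕ (B ++ c ∷ tail) →
              Bounded g l μ (B ++ c ∷ tail) (P * c)
    bounded {l} {B} {P} {N} {c} {tail} μ 1≤μ μ≤2 (state {l₀} {P₀} {N₀} {B₀} {D} status 1≤P₀ block B≡ l≡) refl 1≤P (c≢0 ∷ tail≢0) rem sorted =
      go D block B≡ l≡ (sorted-prefix D (sorted-suffix B₀ (subst Sortedℕ (trans (cong (_++ c ∷ tail) B≡) (++-assoc B₀ D (c ∷ tail))) sorted)))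
      where
      1≤N : 1 ≤ N
      1≤N = remainder-positive {a = c} tail≢0 1≤P rem
      sorted-tail : Sortedℕ (c ∷ tail)
      sorted-tail = sorted-suffix B sorted
      cN≤mP : c * N ≤ suc μ * P
      cN≤mP = remainder-bound sorted-tail tail≢0 rem
      tail≡ : c * N ≡ suc μ * P → tail ≡ replicate μ c
      tail≡ = remainder-bound-≡ sorted-tail tail≢0 1≤P rem

      from-status : ∀ {B₁} → B ≡ B₁ → Status g l B₁ P N → Bounded g l μ (B ++ c ∷ tail) (P * c)
      from-status {B₁} B≡B₁ st = let le , eq⇒ = status-bound {c = c} μ cN≤mP 1≤g st in regular le λ eq →
        let B₁≡ , c≡ , cN≡ = eq⇒ eq in
        cong₂ _++_ (trans B≡B₁ B₁≡) (cong₂ _∷_ c≡ (trans (tail≡ cN≡) (cong (replicate μ) c≡)))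

      long : ∀ {x y D} → Block P₀ N₀ (x ∷ y ∷ D) P N → l ≡ 2 + length D + l₀ → Sortedℕ (x ∷ y ∷ D ++ c ∷ []) →
             κ-Dominated μ (t g (suc l₀)) (length D) →
             Bounded g l μ (B ++ c ∷ tail) (P * c)
      long {D = D} block l≡ sorted κ≤ = from-status refl
        (subst (λ l → Status g l B P N) (sym l≡) (long-block-low {D = D} μ μ≤2 κ≤ status 1≤P₀ block sorted cN≤mP))

      long-exceptional : ∀ {x y} → μ ≡ 2 → Block P₀ N₀ (x ∷ y ∷ []) P N → l ≡ 2 + l₀ → Sortedℕ (x ∷ y ∷ c ∷ []) →
                         t g (suc l₀) ≡ 1 → Bounded g l μ (B ++ c ∷ tail) (P * c)
      long-exceptional {x} {y} μ≡2 block l≡ sorted t≡1 = exceptional μ≡2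
        (trans l≡ (cong (2 +_) (proj₁ (t≡1⇒ l₀ t≡1)))) (proj₂ (t≡1⇒ l₀ t≡1))
        (*-cancelˡ-< N _ _ (begin-strict
          N * (P * c)                   ≡⟨ e₁ N P c ⟩
          P * (c * N)                   ≤⟨ *-monoʳ-≤ P cN≤3P ⟩
          P * (3 * P)                   ≡⟨ e₂ P ⟩
          3 * (P * P)                   <⟨ power-cancel-< {N₀} {3} {128} {N′ = N} (block-bound 2 ≤-refl block 1≤P₀ sorted cN≤3P)
                                             (weak⇒power {P₀} {N₀} (proj₁ (status-≤ status)) (proj₂ (status-≤ status)) 2) ⟩
          128 * (N * t g (suc l₀) ^ 4)  ≡⟨ cong (λ x → 128 * (N * x)) (cong (_^ 4) t≡1) ⟩
          128 * (N * 1 ^ 4)             ≡⟨ e₃ N ⟩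
          N * 128                       ∎))
        where
        open ≤-Reasoning
        cN≤3P : c * N ≤ 3 * P
        cN≤3P = subst (λ μ → c * N ≤ suc μ * P) μ≡2 cN≤mP
        e₁ : ∀ N P c → N * (P * c) ≡ P * (c * N)
        e₁ = solve-∀
        e₂ : ∀ P → P * (3 * P) ≡ 3 * (P * P)
        e₂ = solve-∀
        e₃ : ∀ N → 128 * (N * 1) ≡ N * 128
        e₃ = solve-∀

      go : ∀ D → Block P₀ N₀ D P N → B ≡ B₀ ++ D → l ≡ length D + l₀ → Sortedℕ (D ∷ʳ c) → Bounded g l μ (B ++ c ∷ tail) (P * c)
      go [] [] B≡ refl _ = from-status (trans B≡ (++-identityʳ B₀)) status
      go (x ∷ []) (step P₀<N N+P₀≡ []) B≡ l≡ sorted@(x≤c ∷ _) =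
        let 1≤x = m+n≡o*p⇒1≤p {o = N₀} 1≤N N+P₀≡
            N≤ = block-remainder {m = suc μ} [] 1≤P₀ 1≤x sorted cN≤mP
            le , eq⇒ = singleton-bound {c = c} μ cN≤mP 1≤N status 1≤P₀ P₀<N N+P₀≡ refl x≤c N≤
        in balanced l≡ le λ eq → let B₀≡ , x≡ , c≡ , cN≡ = eq⇒ eq in begin
          B ++ c ∷ tail                              ≡⟨ cong (_++ c ∷ tail) B≡ ⟩
          (B₀ ++ x ∷ []) ++ c ∷ tail                 ≡⟨ ++-assoc B₀ (x ∷ []) (c ∷ tail) ⟩
          B₀ ++ x ∷ c ∷ tail                         ≡⟨ cong₂ _++_ B₀≡ (cong₂ _∷_ x≡ (cong₂ _∷_ c≡ (trans (tail≡ cN≡) (cong (replicate μ) c≡)))) ⟩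
          extremal g l₀ (2 + μ)                      ∎
        where open ≡-Reasoning
      -- Long blocks are handled by `κ-bound₁` if μ = 1 and by `κ-bound₂` if μ = 2, apart from
      -- length two at t = 1.
      go (x ∷ y ∷ D) block B≡ l≡ sorted = helper (m≤n⇒m<n∨m≡n 1≤μ)
        where
        helper : 1 < μ ⊎ 1 ≡ μ → Bounded g l μ (B ++ c ∷ tail) (P * c)
        helper (inj₂ 1≡μ) = long block l≡ sorted
          (subst (λ μ → κ-Dominated μ (t g (suc l₀)) (length D)) 1≡μ (κ-bound₁ (length D) (t≥1 1≤g l₀)))
        helper (inj₁ 2≤μ) = helper₂ D block l≡ sorted (m≤n⇒m<n∨m≡n (t≥1 1≤g l₀))
          where
          2≡μ : 2 ≡ μ
          2≡μ = ≤-antisym 2≤μ μ≤2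
          κ≤ : ∀ D → 2 ≤ t g (suc l₀) ⊎ 1 ≤ length D → κ-Dominated μ (t g (suc l₀)) (length D)
          κ≤ D h = subst (λ μ → κ-Dominated μ (t g (suc l₀)) (length D)) 2≡μ (κ-bound₂ (length D) (t≥1 1≤g l₀) h)
          helper₂ : ∀ D → Block P₀ N₀ (x ∷ y ∷ D) P N → l ≡ 2 + length D + l₀ → Sortedℕ (x ∷ y ∷ D ∷ʳ c) →
                    1 < t g (suc l₀) ⊎ 1 ≡ t g (suc l₀) → Bounded g l μ (B ++ c ∷ tail) (P * c)
          helper₂ []      block l≡ sorted (inj₂ 1≡t) = long-exceptional (sym 2≡μ) block l≡ sorted (sym 1≡t)
          helper₂ []      block l≡ sorted (inj₁ 1<t) = long block l≡ sorted (κ≤ [] (inj₁ 1<t))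
          helper₂ (z ∷ D) block l≡ sorted _          = long block l≡ sorted (κ≤ (z ∷ D) (inj₂ (s≤s z≤n)))

    initial : State g 0 [] g 1
    initial = state (greedy refl (sym (t-1 g)) refl) 1≤g [] refl refl

  -- Splitting off the last entries

  split : ∀ r {k} (A : List ℕ) → length A ≡ r + suc k →
          ∃[ B ] ∃[ c ] ∃[ tail ] A ≡ B ++ c ∷ tail × length B ≡ r × length tail ≡ k
  split zero    (a ∷ A) eq = [] , a , A , refl , refl , suc-injective eq
  split (suc r) (a ∷ A) eq = let B , c , tail , A≡ , B≡ , tail≡ = split r A (suc-injective eq) in
    a ∷ B , c , tail , cong (a ∷_) A≡ , cong suc B≡ , tail≡

  -- X / g is the product of all but the last μ entries of A.
  Leading : ℕ → ℕ → List ℕ → ℕ → Set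
  Leading g μ A X = ∃[ Y ] g * product A ≡ X * Y × Y ≤ lcms A ^ μ

  -- Each trailing entry divides the lcm, so their product is at most the power of the lcm in the
  -- denominator of `F`.
  leading : ∀ {g P c} B tail → All NonZero (B ++ c ∷ tail) → P ≡ g * product B → Leading g (length tail) (B ++ c ∷ tail) (P * c)
  leading {g} {P} {c} B tail A≢0 P≡ = product tail ,
    (begin
      g * product (B ++ c ∷ tail)           ≡⟨ cong (g *_) (product-++ B (c ∷ tail)) ⟩
      g * (product B * (c * product tail))  ≡⟨ e g (product B) c (product tail) ⟩
      g * product B * c * product tail      ≡⟨ cong (λ P → P * c * product tail) P≡ ⟨
      P * c * product tail                  ∎) ,
    product-≤ (All.map (∣⇒≤ {{lcms≢0 A≢0}}) (All.tail (All.++⁻ʳ B (∣lcms (B ++ c ∷ tail)))))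
    where
    open ≡-Reasoning
    e : ∀ g b c d → g * (b * (c * d)) ≡ g * b * c * d
    e = solve-∀

  bounded-leading : ∀ {g A} μ r → 1 ≤ g → 1 ≤ μ → μ ≤ 2 → length A ≡ r + suc μ → All NonZero A → Sortedℕ A → Remainder g 1 A →
                    ∃[ X ] Leading g μ A X × Bounded g r μ A X
  bounded-leading {g} {A} μ r 1≤g 1≤μ μ≤2 |A| A≢0 sorted rem with split r A |A|
  ... | B , c , tail , refl , refl , refl =
    let P , N , σ , rem′ , 1≤P , P≡ = run 1≤g B (initial 1≤g) 1≤g rem A≢0 sorted
    in P * c , leading {g} B tail A≢0 P≡ ,
       subst (λ r → Bounded g r μ (B ++ c ∷ tail) (P * c)) (+-identityʳ (length B))
         (bounded 1≤g μ 1≤μ μ≤2 σ refl 1≤P (All.++⁻ʳ B A≢0) rem′ sorted)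

  -- After `a` only `c` is left, so the remainder is 1 / c ≤ 1 / a. Any open block is therefore
  -- closed at `a`, a status holds there, and no sporadic case arises.
  bounded-product : ∀ {g A} r → 1 ≤ g → length A ≡ 2 + r → All NonZero A → Sortedℕ A → Remainder g 1 A →
                    ∃[ X ] Leading g 0 A X × X ≤ 1 * (t g (2 + r) * t g (2 + r)) ×
                    (X ≡ 1 * (t g (2 + r) * t g (2 + r)) → A ≡ extremal g (suc r) 1)
  bounded-product {g} {A} r 1≤g |A| A≢0 sorted rem with split r A (trans |A| (+-comm 2 r))
  ... | B , a , c ∷ [] , refl , refl , refl =
    let P , N , σ , rem′ , 1≤P , P≡ = run 1≤g B (initial 1≤g) 1≤g rem A≢0 sorted
        a≢0 = All.head (All.++⁻ʳ B A≢0)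
        c≢0 = All.head (All.tail (All.++⁻ʳ B A≢0))
        b , b+P≡Na , rem″ = remainder-∷ {N = N} {a} (c≢0 ∷ []) rem′
        1≤Pa = *-mono-≤ 1≤P (>-nonZero⁻¹ a {{a≢0}})
        1≤b = remainder-positive {a = c} [] 1≤Pa rem″
        cb≤ = remainder-bound {N = b} {c} [-] [] rem″
        a≤c = head-≤ (sorted-suffix B sorted)
        b≤P = *-cancelˡ-≤ c {{c≢0}} (≤-trans cb≤ (≤-trans (≤-reflexive (e P a)) (*-monoˡ-≤ P a≤c)))
        st = close 1≤g σ 1≤b b≤P b+P≡Na (sorted-prefix B sorted)
        le , eq⇒ = status-bound {c = c} 0 cb≤ 1≤g st
    in P * a * c ,
       subst (λ A → Leading g 0 A (P * a * c)) (∷ʳ-++ B a (c ∷ []))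
         (leading {g} (B ∷ʳ a) [] (subst (All NonZero) (sym (∷ʳ-++ B a (c ∷ []))) A≢0)
           (trans (cong (_* a) P≡) (trans (*-assoc g (product B) a) (cong (g *_) (trans (cong (product B *_) (sym (*-identityʳ a))) (sym (product-++ B (a ∷ [])))))))) ,
       subst (λ l → P * a * c ≤ 1 * (t g (2 + l) * t g (2 + l))) (+-identityʳ (length B)) le ,
       λ eq → let B≡ , c≡ , _ = eq⇒ (trans eq (cong (λ l → 1 * (t g (2 + l) * t g (2 + l))) (sym (+-identityʳ (length B))))) in
         trans (sym (∷ʳ-++ B a (c ∷ []))) (trans (cong₂ (λ B c → B ++ c ∷ []) B≡ c≡) (cong (λ l → extremal g (suc l) 1) (+-identityʳ (length B))))
    where
    head-≤ : ∀ {a c} → Sortedℕ (a ∷ c ∷ []) → a ≤ c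
    head-≤ (a≤c ∷ _) = a≤c
    e : ∀ P a → 1 * (P * a) ≡ a * P
    e = solve-∀

  -- From the leading product to F

  module _ {g q d k : ℕ} {A : List ℕ} {X : ℕ} {S : Set} .{{_ : NonZero g}} .{{_ : NonZero d}} (A≢0 : All NonZero A)
           (μ : ℕ) (b : ℕ) (|A|∸k≡μ : length A ∸ k ≡ μ) (bd≡gq : b * d ≡ g * q)
           (leadingX : Leading g μ A X) (X≤b : X ≤ b) (X≡b⇒ : X ≡ b → S) (⇒≡b : S → g * product A ≡ b * lcms A ^ μ) where

    private
      instance
        L^μ≢0 : NonZero (lcms A ^ (length A ∸ k))
        L^μ≢0 = m^n≢0 (lcms A) (length A ∸ k) {{lcms≢0 A≢0}}
      M Y : ℕ
      M = lcms A ^ μ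
      Y = proj₁ leadingX
      L≡ : lcms A ^ (length A ∸ k) ≡ M
      L≡ = cong (lcms A ^_) |A|∸k≡μ
      gA≡ : g * product A ≡ X * Y
      gA≡ = proj₁ (proj₂ leadingX)
      Y≤M : Y ≤ M
      Y≤M = proj₂ (proj₂ leadingX)
      1≤M : 1 ≤ M
      1≤M = >-nonZero⁻¹ M {{m^n≢0 (lcms A) μ {{lcms≢0 A≢0}}}}
      e : ∀ b M d → b * M * d ≡ b * d * M
      e = solve-∀
      bMd≡ : b * M * d ≡ g * (q * M)
      bMd≡ = trans (e b M d) (trans (cong (_* M) bd≡gq) (*-assoc g q M))
      A≤ : product A * d ≤ q * M
      A≤ = *-cancelˡ-≤ g (begin
        g * (product A * d)     ≡⟨ *-assoc g (product A) d ⟨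
        g * product A * d       ≡⟨ cong (_* d) gA≡ ⟩
        X * Y * d               ≤⟨ *-monoˡ-≤ d (*-mono-≤ X≤b Y≤M) ⟩
        b * M * d               ≡⟨ bMd≡ ⟩
        g * (q * M)             ∎)
        where open ≤-Reasoning
      A≡⇒ : product A * d ≡ q * M → S
      A≡⇒ eq with m≤n⇒m<n∨m≡n X≤b
      ... | inj₂ X≡b = X≡b⇒ X≡b
      ... | inj₁ X<b = contradiction XY≡bM (<⇒≢ (begin-strict
        X * Y   ≤⟨ *-monoʳ-≤ X Y≤M ⟩
        X * M   <⟨ *-monoˡ-< M {{>-nonZero 1≤M}} X<b ⟩
        b * M   ∎))
        where
        open ≤-Reasoning
        XY≡bM : X * Y ≡ b * M
        XY≡bM = *-cancelʳ-≡ (X * Y) (b * M) d (trans (cong (_* d) (sym gA≡))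
          (trans (*-assoc g (product A) d) (trans (cong (g *_) eq) (sym bMd≡))))
      S⇒ : S → product A * d ≡ q * M
      S⇒ p = *-cancelˡ-≡ _ _ g (trans (sym (*-assoc g (product A) d)) (trans (cong (_* d) (⇒≡b p)) bMd≡))

    -- F is X Y / (g L^μ), where L is the lcm, X ≤ b, Y ≤ L^μ and b / g = q / d. Since L^μ is
    -- positive, X < b would keep F strictly below q / d, so equality forces X = b.
    F-bound : F k A A≢0 ℚ.≤ ℤ.+ q / d × (F k A A≢0 ≡ ℤ.+ q / d ⇔ S)
    F-bound =
      /-mono-* (product A) _ q d (subst (λ L → product A * d ≤ q * L) (sym L≡) A≤) ,
      mk⇔ (λ eq → A≡⇒ (trans (/-injective-* (product A) _ q d eq) (cong (q *_) L≡)))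
          (λ p → /-cong-* (product A) _ q d (trans (S⇒ p) (cong (q *_) (sym L≡))))

  extremal-regular : ∀ {A} g r μ → A ≡ extremal g r (suc μ) → g * product A ≡ suc μ * (t g (suc r) * t g (suc r)) * lcms A ^ μ
  extremal-regular g r μ refl = begin
    g * product (extremal g r (suc μ))        ≡⟨ product-extremal g r (suc μ) ⟩
    T * (suc μ * T * (suc μ * T) ^ μ)         ≡⟨ e T (suc μ) ((suc μ * T) ^ μ) ⟩
    suc μ * (T * T) * (suc μ * T) ^ μ         ≡⟨ cong (λ L → suc μ * (T * T) * L ^ μ) (lcms-extremal g r μ) ⟨
    suc μ * (T * T) * lcms (extremal g r (suc μ)) ^ μ ∎
    where
    open ≡-Reasoning
    T = t g (suc r)
    e : ∀ T m x → T * (m * T * x) ≡ m * (T * T) * x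
    e = solve-∀

  extremal-balanced : ∀ {A} g l μ → A ≡ extremal g l (2 + μ) → g * product A ≡ κ μ 1 * t g (suc l) ^ 3 * lcms A ^ μ
  extremal-balanced g l μ refl = begin
    g * product (extremal g l (2 + μ))                     ≡⟨ product-extremal g l (2 + μ) ⟩
    T * (L * (L * L ^ μ))                                  ≡⟨ e T (2 + μ) (L ^ μ) ⟩
    (2 + μ) * (2 + μ) * T ^ 3 * L ^ μ                      ≡⟨ cong (λ L → κ μ 1 * T ^ 3 * L ^ μ) (lcms-extremal g l (suc μ)) ⟨
    κ μ 1 * T ^ 3 * lcms (extremal g l (2 + μ)) ^ μ        ∎
    where
    open ≡-Reasoning
    T = t g (suc l)
    L = (2 + μ) * T
    e : ∀ T m x → T * (m * T * (m * T * x)) ≡ m * m * (T * (T * (T * 1))) * x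
    e = solve-∀

  product≡0⇒ : ∀ m n → 1 ≤ m → m * n ≡ 0 → n ≡ 0
  product≡0⇒ (suc m) zero    _ _ = refl

  -- The difference of the two sides is t² (2t - 1)(t - 2). It compares the balanced bound with the
  -- regular one for μ = 1.
  9t³-bound : ∀ {t} → 2 ≤ t → 9 * t ^ 3 ≤ 2 * (t * suc t * (t * suc t)) × (9 * t ^ 3 ≡ 2 * (t * suc t * (t * suc t)) → t ≡ 2)
  9t³-bound {suc (suc u)} (s≤s (s≤s _)) = m+o≡n⇒m≤n w (e u) , λ eq →
    cong (2 +_) (product≡0⇒ ((2 + u) * (2 + u) * (2 * u + 3)) u
      (*-mono-≤ (s≤s (z≤n {suc (u + (1 + u) * (2 + u))})) (≤-trans (s≤s z≤n) (m≤n+m 3 (2 * u))))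
      (+-cancelˡ-≡ (9 * (2 + u) ^ 3) _ _ (trans (e u) (trans (sym eq) (sym (+-identityʳ _))))))
    where
    w = (2 + u) * (2 + u) * (2 * u + 3) * u
    e : ∀ u → 9 * ((2 + u) * ((2 + u) * ((2 + u) * 1))) + (2 + u) * (2 + u) * (2 * u + 3) * u ≡ 2 * ((2 + u) * (3 + u) * ((2 + u) * (3 + u)))
    e = solve-∀

  -- The difference of the two sides is t² (3t - 1)(t - 3). It is the same comparison for μ = 2.
  16t³-bound : ∀ {t} → 3 ≤ t → 16 * t ^ 3 ≤ 3 * (t * suc t * (t * suc t)) × (16 * t ^ 3 ≡ 3 * (t * suc t * (t * suc t)) → t ≡ 3)
  16t³-bound {suc (suc (suc u))} (s≤s (s≤s (s≤s _))) = m+o≡n⇒m≤n w (e u) , λ eq →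
    cong (3 +_) (product≡0⇒ ((3 + u) * (3 + u) * (3 * u + 8)) u
      (*-mono-≤ (s≤s (z≤n {2 + u + (2 + u) * (3 + u)})) (≤-trans (s≤s z≤n) (m≤n+m 8 (3 * u))))
      (+-cancelˡ-≡ (16 * (3 + u) ^ 3) _ _ (trans (e u) (trans (sym eq) (sym (+-identityʳ _))))))
    where
    w = (3 + u) * (3 + u) * (3 * u + 8) * u
    e : ∀ u → 16 * ((3 + u) * ((3 + u) * ((3 + u) * 1))) + (3 + u) * (3 + u) * (3 * u + 8) * u ≡ 3 * ((3 + u) * (4 + u) * ((3 + u) * (4 + u)))
    e = solve-∀

  module _ {g : ℕ} (1≤g : 1 ≤ g) where

    t-2≥6 : 2 ≤ g → 6 ≤ t g 2
    t-2≥6 2≤g = subst (6 ≤_) (sym (t-2 1≤g)) (*-mono-≤ 2≤g (s≤s 2≤g))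

    -- Here the two bounds for μ = 1 tie, and the balanced lists for these pairs are (6,6,6) and
    -- (2,6,6,6).
    t≡2⇒ : ∀ l → t g (suc l) ≡ 2 → (l ≡ 0 × g ≡ 2) ⊎ (l ≡ 1 × g ≡ 1)
    t≡2⇒ zero          eq = inj₁ (refl , trans (sym (t-1 g)) eq)
    t≡2⇒ (suc zero)    eq with m≤n⇒m<n∨m≡n 1≤g
    ... | inj₂ 1≡g = inj₂ (refl , sym 1≡g)
    ... | inj₁ 2≤g = contradiction (≤-trans (t-2≥6 2≤g) (≤-reflexive eq)) λ { (s≤s (s≤s ())) }
    t≡2⇒ (suc (suc l)) eq = contradiction (≤-trans (t≥6 1≤g l) (≤-reflexive eq)) λ { (s≤s (s≤s ())) }

    -- Here the two bounds for μ = 2 tie, with balanced list (12,12,12,12).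
    t≡3⇒ : ∀ l → t g (suc l) ≡ 3 → l ≡ 0 × g ≡ 3
    t≡3⇒ zero          eq = refl , trans (sym (t-1 g)) eq
    t≡3⇒ (suc zero)    eq with m≤n⇒m<n∨m≡n 1≤g
    ... | inj₂ refl = contradiction eq λ ()
    ... | inj₁ 2≤g = contradiction (≤-trans (t-2≥6 2≤g) (≤-reflexive eq)) λ { (s≤s (s≤s (s≤s ()))) }
    t≡3⇒ (suc (suc l)) eq = contradiction (≤-trans (t≥6 1≤g l) (≤-reflexive eq)) λ { (s≤s (s≤s (s≤s ()))) }

    t≥2-unless : ∀ l → ¬ (l ≡ 0 × g ≡ 1) → 2 ≤ t g (suc l)
    t≥2-unless l h = ≤∧≢⇒< (t≥1 1≤g l) λ eq → h (t≡1⇒ 1≤g l (sym eq))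

    t≥3-unless : ∀ l → ¬ (l ≡ 0 × (g ≡ 1 ⊎ g ≡ 2)) → ¬ (l ≡ 1 × g ≡ 1) → 3 ≤ t g (suc l)
    t≥3-unless l h₁ h₂ = ≤∧≢⇒< (t≥2-unless l λ (l≡0 , g≡1) → h₁ (l≡0 , inj₁ g≡1)) λ eq → excluded (t≡2⇒ l (sym eq))
      where
      excluded : ¬ ((l ≡ 0 × g ≡ 2) ⊎ (l ≡ 1 × g ≡ 1))
      excluded (inj₁ (l≡0 , g≡2)) = h₁ (l≡0 , inj₂ g≡2)
      excluded (inj₂ h)           = h₂ h

  target : ∀ m T g → m * (T * T) * g ≡ g * (m * T ^ 2)
  target = e
    where
    e : ∀ m T g → m * (T * T) * g ≡ g * (m * (T * (T * 1)))
    e = solve-∀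

  -- The bounds for F in the generic and in the exceptional cases

  module _ {g : ℕ} {A : List ℕ} .{{_ : NonZero g}} (A≢0 : All NonZero A) (sorted : Sortedℕ A) (rem : Remainder g 1 A) where

    private
      1≤g : 1 ≤ g
      1≤g = >-nonZero⁻¹ g

      exponent : ∀ μ {k} → length A ≡ μ + k → length A ∸ k ≡ μ
      exponent μ {k} |A| = trans (cong (_∸ k) |A|) (m+n∸n≡m μ k)

    F-n : ∀ j → length A ≡ 3 + j →
          F (3 + j) A A≢0 ℚ.≤ ℤ.+ (t g (3 + j) ^ 2) / g
        × (F (3 + j) A A≢0 ≡ ℤ.+ (t g (3 + j) ^ 2) / g ⇔ A ≡ sylvester g (2 + j) ++ t g (3 + j) ∷ [])
    F-n j |A| = let X , lead , le , eq⇒ = bounded-product (suc j) 1≤g |A| A≢0 sorted rem in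
      F-bound {k = 3 + j} A≢0 0 (1 * (T * T)) (exponent 0 |A|) (trans (target 1 T g) (cong (g *_) (*-identityˡ (T ^ 2)))) lead le
        (λ eq → trans (eq⇒ eq) (cong (λ x → sylvester g (2 + j) ++ x ∷ []) (*-identityˡ T)))
        (λ A≡ → extremal-regular g (2 + j) 0 (trans A≡ (cong (λ x → sylvester g (2 + j) ++ x ∷ []) (sym (*-identityˡ T)))))
      where T = t g (3 + j)

    -- Excluding j = 0, g = 1 ensures t ≥ 2 at the start of a block of length one, so that the
    -- balanced bound does not exceed the regular one.
    F-n-1 : ∀ j → length A ≡ 3 + j → ¬ (j ≡ 0 × g ≡ 1) →
          F (2 + j) A A≢0 ℚ.≤ ℤ.+ (2 * t g (2 + j) ^ 2) / g
        × (F (2 + j) A A≢0 ≡ ℤ.+ (2 * t g (2 + j) ^ 2) / g ⇔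
            (A ≡ 6 ∷ 6 ∷ 6 ∷ [] ⊎ A ≡ 2 ∷ 6 ∷ 6 ∷ 6 ∷ [] ⊎ A ≡ extremal g (suc j) 2))
    F-n-1 j |A| ¬exc = let X , lead , bnd = bounded-leading 1 (suc j) 1≤g ≤-refl (s≤s z≤n) (trans |A| (+-comm 2 (suc j))) A≢0 sorted rem
                           le , eq⇒ = conclude bnd in
      F-bound {k = 2 + j} A≢0 1 (2 * (T * T)) (exponent 1 |A|) (target 2 T g) lead le eq⇒ converse
      where
      T = t g (2 + j)
      S = A ≡ 6 ∷ 6 ∷ 6 ∷ [] ⊎ A ≡ 2 ∷ 6 ∷ 6 ∷ 6 ∷ [] ⊎ A ≡ extremal g (suc j) 2
      t₀ = t g (suc j)
      T≡ : 2 * (t₀ * suc t₀ * (t₀ * suc t₀)) ≡ 2 * (T * T)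
      T≡ = cong (λ x → 2 * (x * x)) (sym (t-suc g j))
      9t³ = 9t³-bound (t≥2-unless 1≤g j ¬exc)

      small : A ≡ extremal g j 3 → (j ≡ 0 × g ≡ 2) ⊎ (j ≡ 1 × g ≡ 1) → S
      small A≡ (inj₁ (refl , refl)) = inj₁ A≡
      small A≡ (inj₂ (refl , refl)) = inj₂ (inj₁ A≡)

      conclude : ∀ {X} → Bounded g (suc j) 1 A X → X ≤ 2 * (T * T) × (X ≡ 2 * (T * T) → S)
      conclude (regular le eq⇒)         = le , λ eq → inj₂ (inj₂ (eq⇒ eq))
      conclude {X} (balanced refl le eq⇒) = ≤-trans le 9t³≤ , λ eq →
        let 9t³≡ = ≤-antisym 9t³≤ (≤-trans (≤-reflexive (sym eq)) le)
        in small (eq⇒ (trans eq (sym 9t³≡))) (t≡2⇒ 1≤g j (proj₂ 9t³ (trans 9t³≡ (sym T≡))))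
        where
        9t³≤ : 9 * t₀ ^ 3 ≤ 2 * (T * T)
        9t³≤ = ≤-trans (proj₁ 9t³) (≤-reflexive T≡)
      conclude (exceptional () _ _ _)

      converse : S → g * product A ≡ 2 * (T * T) * lcms A ^ 1
      -- The list determines g: its unreduced reciprocal sum is 108 / 216, so g = 2. Similarly
      -- (2,6,6,6) has 432 / 432, so g = 1.
      converse (inj₁ A≡) = case₁ A≡ (suc-injective (suc-injective (suc-injective (trans (sym |A|) (cong length A≡)))))
                             (*-cancelˡ-≡ g 2 108 (subst (Remainder g 1) A≡ rem))
        where
        case₁ : A ≡ 6 ∷ 6 ∷ 6 ∷ [] → j ≡ 0 → g ≡ 2 → g * product A ≡ 2 * (T * T) * lcms A ^ 1
        case₁ A≡ refl refl = extremal-balanced 2 0 1 A≡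
      converse (inj₂ (inj₁ A≡)) = case₂ A≡ (suc-injective (suc-injective (suc-injective (trans (sym |A|) (cong length A≡)))))
                             (*-cancelˡ-≡ g 1 432 (subst (Remainder g 1) A≡ rem))
        where
        case₂ : A ≡ 2 ∷ 6 ∷ 6 ∷ 6 ∷ [] → j ≡ 1 → g ≡ 1 → g * product A ≡ 2 * (T * T) * lcms A ^ 1
        case₂ A≡ refl refl = extremal-balanced 1 1 1 A≡
      converse (inj₂ (inj₂ A≡)) = extremal-regular g (suc j) 1 A≡

    -- The excluded pairs are those for which a block of length one would start at t = 1 or t = 2;
    -- from t = 3 on `16t³-bound` applies.
    F-n-2 : ∀ j → length A ≡ 3 + j → ¬ (j ≡ 1 × (g ≡ 1 ⊎ g ≡ 2)) → ¬ (j ≡ 2 × g ≡ 1) →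
          F (1 + j) A A≢0 ℚ.≤ ℤ.+ (3 * t g (1 + j) ^ 2) / g
        × (F (1 + j) A A≢0 ≡ ℤ.+ (3 * t g (1 + j) ^ 2) / g ⇔
            (A ≡ 12 ∷ 12 ∷ 12 ∷ 12 ∷ [] ⊎ A ≡ extremal g j 3))
    F-n-2 j |A| ¬exc₁ ¬exc₂ = let X , lead , bnd = bounded-leading 2 j 1≤g (s≤s z≤n) ≤-refl (trans |A| (+-comm 3 j)) A≢0 sorted rem
                                  le , eq⇒ = conclude bnd in
      F-bound {k = 1 + j} A≢0 2 (3 * (T * T)) (exponent 2 |A|′) (target 3 T g) lead le eq⇒ converse
      where
      T = t g (1 + j)
      S = A ≡ 12 ∷ 12 ∷ 12 ∷ 12 ∷ [] ⊎ A ≡ extremal g j 3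
      |A|′ : length A ≡ 2 + (1 + j)
      |A|′ = |A|

      small : ∀ {l} → A ≡ extremal g l 4 → l ≡ 0 × g ≡ 3 → S
      small A≡ (refl , refl) = inj₁ A≡

      conclude : ∀ {X} → Bounded g j 2 A X → X ≤ 3 * (T * T) × (X ≡ 3 * (T * T) → S)
      conclude (regular le eq⇒)             = le , λ eq → inj₂ (eq⇒ eq)
      conclude {X} (balanced {l} refl le eq⇒) = ≤-trans le 16t³≤ , λ eq →
        let 16t³≡ = ≤-antisym 16t³≤ (≤-trans (≤-reflexive (sym eq)) le)
        in small (eq⇒ (trans eq (sym 16t³≡))) (t≡3⇒ 1≤g l (proj₂ 16t³ (trans 16t³≡ (sym T≡))))
        where
        t₀ = t g (suc l)
        T≡ : 3 * (t₀ * suc t₀ * (t₀ * suc t₀)) ≡ 3 * (T * T)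
        T≡ = cong (λ x → 3 * (x * x)) (sym (t-suc g l))
        16t³ = 16t³-bound (t≥3-unless 1≤g l (λ (l≡0 , h) → ¬exc₁ (cong suc l≡0 , h)) (λ (l≡1 , h) → ¬exc₂ (cong suc l≡1 , h)))
        16t³≤ : 16 * t₀ ^ 3 ≤ 3 * (T * T)
        16t³≤ = ≤-trans (proj₁ 16t³) (≤-reflexive T≡)
      conclude (exceptional _ j≡2 g≡1 _) = contradiction (j≡2 , g≡1) ¬exc₂

      converse : S → g * product A ≡ 3 * (T * T) * lcms A ^ 2
      -- The unreduced reciprocal sum is 6912 / 20736, so g = 3.
      converse (inj₁ A≡) = case₁ A≡ (suc-injective (suc-injective (suc-injective (trans (sym |A|) (cong length A≡)))))
                             (*-cancelˡ-≡ g 3 6912 (subst (Remainder g 1) A≡ rem))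
        where
        case₁ : A ≡ 12 ∷ 12 ∷ 12 ∷ 12 ∷ [] → j ≡ 1 → g ≡ 3 → g * product A ≡ 3 * (T * T) * lcms A ^ 2
        case₁ A≡ refl refl = extremal-balanced 3 0 2 A≡
      converse (inj₂ A≡) = extremal-regular g j 2 A≡

    -- For small t the order of the two bounds is reversed: the balanced one strictly exceeds the
    -- regular one, so only the balanced list attains it. The condition on 128 keeps an
    -- `exceptional` outcome strictly below it as well.
    F-balanced : ∀ l μ → 1 ≤ μ → μ ≤ 2 → length A ≡ μ + (2 + l) →
                 suc μ * (t g (2 + l) * t g (2 + l)) < κ μ 1 * t g (suc l) ^ 3 →
                 (l ≡ 1 → g ≡ 1 → 128 ≤ κ μ 1 * t g (suc l) ^ 3) →
                 ∀ q d .{{_ : NonZero d}} → κ μ 1 * t g (suc l) ^ 3 * d ≡ g * q →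
                 F (2 + l) A A≢0 ℚ.≤ ℤ.+ q / d × (F (2 + l) A A≢0 ≡ ℤ.+ q / d ⇔ A ≡ extremal g l (2 + μ))
    F-balanced l μ 1≤μ μ≤2 |A| regular< exceptional≤ q d b≡ =
      let X , lead , bnd = bounded-leading μ (suc l) 1≤g 1≤μ μ≤2 (trans |A| (trans (+-suc μ (suc l)) (+-comm (suc μ) (suc l)))) A≢0 sorted rem
          le , eq⇒ = conclude bnd
      in F-bound {k = 2 + l} A≢0 μ b (exponent μ |A|) b≡ lead le eq⇒ (extremal-balanced g l μ)
      where
      b = κ μ 1 * t g (suc l) ^ 3
      conclude : ∀ {X} → Bounded g (suc l) μ A X → X ≤ b × (X ≡ b → A ≡ extremal g l (2 + μ))
      conclude (regular le _)                = <⇒≤ X<b , λ eq → contradiction eq (<⇒≢ X<b)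
        where X<b = ≤-trans (s≤s le) regular<
      conclude (balanced refl le eq⇒)        = le , eq⇒
      conclude (exceptional _ 1+l≡2 g≡1 X<128) = <⇒≤ X<b , λ eq → contradiction eq (<⇒≢ X<b)
        where X<b = ≤-trans X<128 (exceptional≤ (suc-injective 1+l≡2) g≡1)

-- Assembling the bounds for lists with reciprocal sum 1 / g

open import Data.Integer.Base using (+_)
open import Data.List.Base using (List; []; _∷_; _++_; length)
open import Data.List.Relation.Unary.All using (All)
open import Data.List.Relation.Unary.Sorted.TotalOrder using (Sorted)
open import Data.Nat.Base using (ℕ; _*_; _∸_; _^_; NonZero) renaming (_≤_ to _≤ℕ_)
open import Data.Nat.Properties using (≤-totalOrder)
open import Data.Product.Base using (_×_)
open import Data.Rational.Base using (_/_; _≤_)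
open import Data.Sum.Base using (_⊎_)
open import Function.Bundles using (_⇔_)
open import Relation.Binary.PropositionalEquality using (_≡_)
open import Relation.Nullary.Negation using (¬_)
open import Data.Nat.Base using (zero; suc; z≤n; s≤s)
open import Data.Nat.Properties using (≤-refl; n≤1+n; m≤m+n)
open import Data.Product.Base using (_,_)
open import Data.Sum.Base using (inj₁; inj₂)
open import Relation.Binary.PropositionalEquality using (refl)
open EgyptianFractions

theorem3p2 :
  (g n : ℕ) .{{_ : NonZero g}} → 3 ≤ℕ n →
  (A : List ℕ) → length A ≡ n → (A≢0 : All NonZero A) →
  Sorted ≤-totalOrder A → reciprocalSum A A≢0 ≡ + 1 / g →
  ( F n A A≢0 ≤ + (t g n ^ 2) / g
  × (F n A A≢0 ≡ + (t g n ^ 2) / g ⇔ A ≡ sylvester g (n ∸ 1) ++ t g n ∷ []))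
  ×
  ( (n ≡ 3 × g ≡ 1 →
      F 2 A A≢0 ≤ + 9 / 1
    × (F 2 A A≢0 ≡ + 9 / 1 ⇔ A ≡ 3 ∷ 3 ∷ 3 ∷ []))
  × (¬ (n ≡ 3 × g ≡ 1) →
      F (n ∸ 1) A A≢0 ≤ + (2 * t g (n ∸ 1) ^ 2) / g
    × (F (n ∸ 1) A A≢0 ≡ + (2 * t g (n ∸ 1) ^ 2) / g ⇔
        ( A ≡ 6 ∷ 6 ∷ 6 ∷ []
        ⊎ A ≡ 2 ∷ 6 ∷ 6 ∷ 6 ∷ []
        ⊎ A ≡ sylvester g (n ∸ 2) ++ 2 * t g (n ∸ 1) ∷ 2 * t g (n ∸ 1) ∷ []))))
  ×
  ( (n ≡ 4 × (g ≡ 1 ⊎ g ≡ 2) →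
      F 2 A A≢0 ≤ + (16 * g ^ 2) / 1
    × (F 2 A A≢0 ≡ + (16 * g ^ 2) / 1 ⇔
        A ≡ 4 * g ∷ 4 * g ∷ 4 * g ∷ 4 * g ∷ []))
  × (n ≡ 5 × g ≡ 1 →
      F 3 A A≢0 ≤ + 128 / 1
    × (F 3 A A≢0 ≡ + 128 / 1 ⇔ A ≡ 2 ∷ 8 ∷ 8 ∷ 8 ∷ 8 ∷ []))
  × (¬ (n ≡ 4 × (g ≡ 1 ⊎ g ≡ 2)) → ¬ (n ≡ 5 × g ≡ 1) →
      F (n ∸ 2) A A≢0 ≤ + (3 * t g (n ∸ 2) ^ 2) / g
    × (F (n ∸ 2) A A≢0 ≡ + (3 * t g (n ∸ 2) ^ 2) / g ⇔
        ( A ≡ 12 ∷ 12 ∷ 12 ∷ 12 ∷ []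
        ⊎ A ≡ sylvester g (n ∸ 3) ++
              3 * t g (n ∸ 2) ∷ 3 * t g (n ∸ 2) ∷ 3 * t g (n ∸ 2) ∷ []))))
theorem3p2 g (suc (suc (suc j))) _ A |A| A≢0 sorted sum≡1/g =
  F-n A≢0 sorted rem j |A| ,
  -- The regular bound is 2 · 2² = 8, the balanced one 9 · 1³ = 9.
  ( (λ { (refl , refl) → F-balanced A≢0 sorted rem 0 1 ≤-refl (n≤1+n 1) |A| ≤-refl (λ ()) 9 1 refl })
  , λ ¬3,1 → F-n-1 A≢0 sorted rem j |A| λ { (refl , refl) → ¬3,1 (refl , refl) } ) ,
  -- Regular against balanced: 3 · 2² = 12 < 16 for g = 1, and 3 · 6² = 108 < 16 · 2³ = 128 for g =
  -- 2, where 128 / g = 64.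
  ( (λ { (refl , inj₁ refl) → F-balanced A≢0 sorted rem 0 2 (n≤1+n 1) ≤-refl |A| (m≤m+n 13 3) (λ ()) 16 1 refl
       ; (refl , inj₂ refl) → F-balanced A≢0 sorted rem 0 2 (n≤1+n 1) ≤-refl |A| (m≤m+n 109 19) (λ ()) 64 1 refl })
  -- Again 108 < 128, as t_{1,2} = 2; the exceptional outcome X < 128 falls just short of this
  -- bound.
  , (λ { (refl , refl) → F-balanced A≢0 sorted rem 1 2 (n≤1+n 1) ≤-refl |A| (m≤m+n 109 19) (λ _ _ → ≤-refl) 128 1 refl })
  , λ ¬4,12 ¬5,1 → F-n-2 A≢0 sorted rem j |A|
      (λ { (refl , g≡) → ¬4,12 (refl , g≡) }) (λ { (refl , refl) → ¬5,1 (refl , refl) }) )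
  where
  rem : Remainder g 1 A
  rem = reciprocalSum⇒remainder A≢0 sum≡1/g
theorem3p2 g 0 ()
theorem3p2 g 1 (s≤s ())
theorem3p2 g 2 (s≤s (s≤s ()))
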